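{- Let $n=p_1^{\alpha_1}p_2^{\alpha_2}\cdots p_r^{\alpha_r}$, where $r\geq 2$, $\alpha_1,\ldots,\alpha_r$ are positive integers and $p_1<p_2<\cdots<p_r$ are prime numbers. Suppose that at least one of the following holds: (i) $2\phi(p_1p_2\cdots p_r)\geq p_1p_2\cdots p_r$; (ii) $\phi(p_{i+1})\geq r\,\phi(p_i)$ for each $i\in\{1,2,\ldots,r-1\}$. If $t\in\{2,3,\ldots,r\}$ is the largest integer such that $\alpha_t\geq\alpha_j$ for all $2\leq j\leq r$, then $$\delta(\mathcal{P}(C_n))=\min\{\deg(p_s^{\alpha_s}) : t\leq s\leq r\}.$$
   Context: For a finite group $G$, the power graph $\mathcal{P}(G)$ is the simple undirected graph with vertex set $G$ in which two distinct vertices are adjacent if one of them is an integral power of the other. $C_n$ denotes the cyclic group of order $n$, identified with $\mathbb{Z}_n=\{0,1,\ldots,n-1\}$; a positive divisor $d$ of $n$ is regarded as the vertex $d \bmod n$. $\deg(a)$ denotes the degree of vertex $a$ in $\mathcal{P}(C_n)$, $\delta(\mathcal{P}(C_n))$ the minimum degree, and $\phi$ Euler's totient function. -}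

module Defs where

open import Data.Bool using (Bool; not; _∧_; _∨_)
open import Data.Nat using (ℕ; zero; suc; _≡ᵇ_; _⊓_)
open import Data.Nat.DivMod using (_%_; m%n<n)
open import Data.Nat.GCD using (gcd)
open import Data.Fin using (Fin; toℕ; fromℕ<)
open import Data.List using (List; []; _∷_; length; filterᵇ; allFin; map; upTo)
open import Data.Bool.ListAction using (any)

φ : ℕ → ℕ
φ n = length (filterᵇ (λ k → gcd k n ≡ᵇ 1) (map suc (upTo n)))

-- In C_n ≅ ℤ_n (additive), b is an integral power of a iff b ≡ k·a (mod n)
-- for some integer k; it suffices to let k range over 0,…,n-1.
isPowerOf : ∀ {n} → Fin n → Fin n → Bool
isPowerOf {suc m} b a =
  any (λ k → ((toℕ k Data.Nat.* toℕ a) % suc m) ≡ᵇ toℕ b) (allFin (suc m))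

adjacent : ∀ {n} → Fin n → Fin n → Bool
adjacent a b = not (toℕ a ≡ᵇ toℕ b) ∧ (isPowerOf a b ∨ isPowerOf b a)

deg : ∀ {n} → Fin n → ℕ
deg {n} a = length (filterᵇ (adjacent a) (allFin n))

degOf : ℕ → ℕ → ℕ
degOf zero    x = 0
degOf (suc m) x = deg {suc m} (fromℕ< (m%n<n x (suc m)))

minList : List ℕ → ℕ
minList []       = 0
minList (x ∷ []) = x
minList (x ∷ y ∷ xs) = x ⊓ minList (y ∷ xs)

δ : ℕ → ℕ
δ n = minList (map (deg {n}) (allFin n))

{-# OPTIONS --safe #-}

-- Write P_k = p_k^α_k. By the Chinese remainder theorem and inclusion–exclusion,
--   1 + deg x = ∏ u_k + ∏ f_k − ∏ g_k,
-- where the k-th factors depend only on β_k = min(v_{p_k}(x), α_k). Suppose β_j ≥ 1 and i < j. Then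
-- replacing β_i by 0 does not increase this value as soon as
-- ∏_{k ≠ i} (1 − 1/p_k) ≥ p_i / (p_i + p_j − 1), which both hypotheses (i) and (ii) imply: under (ii)
-- the product telescopes to at least 1/r, and to at least 1/2 for the smallest prime. Hence only
-- vertices with a single nonzero β_s matter, and among those the value is smallest for β_s = α_s.
-- Finally p_t^α_t beats p_s^α_s for every s < t: if s is not the first index because P_s ≤ P_t, and if
-- it is by the bound 1/2 when α_t ≥ 2, while α_t = 1 forces t = r and the primes being distinct is enough.
module Submission where

open import Defs
open import Data.Bool using (Bool; true; false; not; _∧_; _∨_; if_then_else_; T; T?)
open import Data.Nat using (ℕ; zero; suc; pred; _+_; _*_; _∸_; _^_; _≡ᵇ_; _≤ᵇ_; _≤_; _<_; z≤n; s≤s;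
  NonZero; >-nonZero; >-nonZero⁻¹; nonTrivial⇒≢1; nonTrivial⇒n>1)
open import Data.Nat.Properties
open import Data.Nat.Coprimality using (Coprime; coprime-Bézout; coprime-divisor; coprime⇒gcd≡1; 1-coprimeTo)
  renaming (sym to coprime-sym)
open import Data.Nat.Divisibility
open import Data.Nat.DivMod
open import Data.Nat.GCD
open import Data.Nat.ListAction using (product)
open import Data.Nat.Primality using (Prime; prime⇒irreducible; prime⇒nonTrivial; prime⇒nonZero)
open import Data.Nat.Tactic.RingSolver using (solve-∀)
open import Data.Fin using (Fin; zero; suc; toℕ; fromℕ<; punchIn; punchOut)
open import Data.Fin.Properties using (all?; toℕ<n; toℕ-fromℕ<; toℕ-injective; punchInᵢ≢i; punchIn-punchOut;
  punchIn-mono-≤; punchIn-injective)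
open import Data.List using (List; []; _∷_; length; filterᵇ; allFin; map; tabulate; applyUpTo)
open import Data.List.Membership.Propositional using (_∈_; lose; find)
open import Data.List.Membership.Propositional.Properties using (∈-allFin; ∈-map⁺; ∈-map⁻; ∈-filter⁺)
open import Data.List.Relation.Unary.Any using (here; there)
open import Data.List.Relation.Unary.Any.Properties using (any⁺; any⁻)
open import Data.Product using (_×_; _,_; ∃-syntax; proj₁; proj₂)
open import Data.Sum using (_⊎_; inj₁; inj₂)
open import Function using (_∘_; id; mk⇔)
open import Relation.Binary using (tri<; tri≈; tri>)
open import Relation.Binary.PropositionalEquality
open import Relation.Nullary using (Dec; yes; no; ¬_; does; contradiction; ¬?; _×-dec_)
open import Relation.Nullary.Decidable using (does-⇔; dec-true; dec-false)
open import Algebra.Properties.CommutativeMonoid.Sum *-1-commutativeMonoid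
  using () renaming (sum to ∏; ∑-distrib-+ to ∏-distrib-*; sum-remove to ∏-remove)
open import Algebra.Properties.CommutativeSemigroup +-commutativeSemigroup
  using () renaming (interchange to +-interchange; x∙yz≈y∙xz to +-swap)
open import Algebra.Properties.CommutativeSemigroup *-commutativeSemigroup
  using () renaming (x∙yz≈y∙xz to *-swap)
open ≤-Reasoning

-- The first prime stands apart twice. The maximality of `α_t` says nothing about `α_1`, so `P_1`
-- can exceed `P_t` by any factor, and no comparison of prime powers disposes of the vertex
-- `p_1^α_1`; the inequality used there has to be uniform in `α_1`, and the factor `p_1^(α_1 − 1)`
-- cancels from it. Under (ii) the first prime also decides which bound serves. For a later `i`, the
-- product over `k ≠ i` contains the first prime, which may be 2, so 1/r is the bound obtained; it
-- suffices because `p_j − 1 ≥ r (p_i − 1)` and `p_i − 1 ≥ r`. For the first `i` the second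
-- inequality may fail, but then all remaining primes exceed `r`, which lifts the product to 1/2.
-- Indices in the code start at 0: the first prime has index `zero`, and `t ≥ 2` reads `1 ≤ toℕ t`.

-- Finite sums and periodic functions

Σ< : ℕ → (ℕ → ℕ) → ℕ
Σ< zero    h = 0
Σ< (suc m) h = h 0 + Σ< m (h ∘ suc)

Σ-cong< : ∀ m {f g : ℕ → ℕ} → (∀ y → y < m → f y ≡ g y) → Σ< m f ≡ Σ< m g
Σ-cong< zero    eq = refl
Σ-cong< (suc m) eq = cong₂ _+_ (eq 0 (s≤s z≤n)) (Σ-cong< m λ y y<m → eq (suc y) (s≤s y<m))

Σ-cong : ∀ m {f g : ℕ → ℕ} → (∀ y → f y ≡ g y) → Σ< m f ≡ Σ< m g
Σ-cong m eq = Σ-cong< m λ y _ → eq y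

Σ-distrib-+ : ∀ m (f g : ℕ → ℕ) → Σ< m (λ y → f y + g y) ≡ Σ< m f + Σ< m g
Σ-distrib-+ zero    f g = refl
Σ-distrib-+ (suc m) f g = trans (cong (f 0 + g 0 +_) (Σ-distrib-+ m (f ∘ suc) (g ∘ suc)))
  (+-interchange (f 0) (g 0) _ _)

Σ-distribˡ-* : ∀ m c (f : ℕ → ℕ) → Σ< m (λ y → c * f y) ≡ c * Σ< m f
Σ-distribˡ-* zero    c f = sym (*-zeroʳ c)
Σ-distribˡ-* (suc m) c f = trans (cong (c * f 0 +_) (Σ-distribˡ-* m c (f ∘ suc)))
  (sym (*-distribˡ-+ c (f 0) _))

Σ-const : ∀ m c → Σ< m (λ _ → c) ≡ m * c
Σ-const zero    c = refl
Σ-const (suc m) c = cong (c +_) (Σ-const m c)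

Σ-++ : ∀ a b h → Σ< (a + b) h ≡ Σ< a h + Σ< b (λ y → h (a + y))
Σ-++ zero    b h = refl
Σ-++ (suc a) b h = trans (cong (h 0 +_) (Σ-++ a b (h ∘ suc))) (sym (+-assoc (h 0) _ _))

Σ-blocks : ∀ N M h → Σ< (N * M) h ≡ Σ< N (λ b → Σ< M (λ a → h (b * M + a)))
Σ-blocks zero    M h = refl
Σ-blocks (suc N) M h = trans (Σ-++ M (N * M) h) (cong (Σ< M h +_)
  (trans (Σ-blocks N M (λ y → h (M + y)))
         (Σ-cong N λ b → Σ-cong M λ a → cong h (sym (+-assoc M (b * M) a)))))

Σ-comm : ∀ m n (f : ℕ → ℕ → ℕ) → Σ< m (λ a → Σ< n (f a)) ≡ Σ< n (λ b → Σ< m (λ a → f a b))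
Σ-comm zero    n f = sym (trans (Σ-const n 0) (*-zeroʳ n))
Σ-comm (suc m) n f = trans (cong (Σ< n (f 0) +_) (Σ-comm m n (f ∘ suc)))
  (sym (Σ-distrib-+ n (f 0) _))

Periodic : ℕ → (ℕ → ℕ) → Set
Periodic N h = ∀ y → h (N + y) ≡ h y

periodic-* : ∀ {N h} → Periodic N h → ∀ c y → h (c * N + y) ≡ h y
periodic-* per zero    y = refl
periodic-* {N} {h} per (suc c) y =
  trans (cong h (+-assoc N (c * N) y)) (trans (per (c * N + y)) (periodic-* per c y))

periodic-multiple : ∀ {N M h} → N ∣ M → Periodic N h → Periodic M h
periodic-multiple (divides c refl) per = periodic-* per c

periodic-∘suc : ∀ {N h} → Periodic N h → Periodic N (h ∘ suc)
periodic-∘suc {N} {h} per y = trans (cong h (sym (+-suc N y))) (per (suc y))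

Σ-suc : ∀ {N h} → Periodic N h → Σ< N (h ∘ suc) ≡ Σ< N h
Σ-suc {N} {h} per = +-cancelˡ-≡ (h 0) _ _ (begin-equality
  Σ< (suc N) h                   ≡⟨ cong (λ m → Σ< m h) (+-comm 1 N) ⟩
  Σ< (N + 1) h                   ≡⟨ Σ-++ N 1 h ⟩
  Σ< N h + (h (N + 0) + 0)       ≡⟨ cong (Σ< N h +_) (trans (+-identityʳ _) (per 0)) ⟩
  Σ< N h + h 0                   ≡⟨ +-comm (Σ< N h) (h 0) ⟩
  h 0 + Σ< N h                   ∎)

Σ-shift : ∀ {N h} → Periodic N h → ∀ a → Σ< N (λ y → h (y + a)) ≡ Σ< N h
Σ-shift {N} {h} per zero    = Σ-cong N λ y → cong h (+-identityʳ y)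
Σ-shift {N} {h} per (suc a) = trans (Σ-cong N λ y → cong h (+-suc y a))
  (trans (Σ-shift (periodic-∘suc per) a) (Σ-suc per))

-- As a function of the offset, the sum below has the coprime periods M and N, so it is constant;
-- averaging over the offsets 0, …, N − 1 then gives its value.
module Progression {M N : ℕ} (cop : Coprime M N) {R : ℕ → ℕ} (perR : Periodic N R) where

  S : ℕ → ℕ
  S a = Σ< N (λ b → R (b * M + a))

  S-period-N : Periodic N S
  S-period-N a = Σ-cong N λ b → trans (cong R (+-swap (b * M) N a)) (perR (b * M + a))

  -- Adding `M` to the offset amounts to raising `b` by one, and the summand has period `N` in `b`.
  S-period-M : Periodic M S
  S-period-M a = trans (Σ-cong N λ b → cong R (assoc′ (b * M) M a)) (Σ-suc {N} {λ b → R (b * M + a)} per)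
    where
    assoc′ : ∀ x y z → x + (y + z) ≡ (y + x) + z
    assoc′ = solve-∀
    expand : ∀ n b m a → (n + b) * m + a ≡ m * n + (b * m + a)
    expand = solve-∀
    per : Periodic N (λ b → R (b * M + a))
    per b = trans (cong R (expand N b M a)) (periodic-* perR M (b * M + a))

  S-suc : ∀ a → S (suc a) ≡ S a
  S-suc a with coprime-Bézout cop
  ... | Bézout.+- x y eq = begin-equality
    S (suc a)            ≡⟨ periodic-* S-period-N y (suc a) ⟨
    S (y * N + suc a)    ≡⟨ cong S (trans (+-suc (y * N) a) (cong (_+ a) eq)) ⟩
    S (x * M + a)        ≡⟨ periodic-* S-period-M x a ⟩
    S a                  ∎
  ... | Bézout.-+ x y eq = begin-equality
    S (suc a)            ≡⟨ periodic-* S-period-M x (suc a) ⟨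
    S (x * M + suc a)    ≡⟨ cong S (trans (+-suc (x * M) a) (cong (_+ a) eq)) ⟩
    S (y * N + a)        ≡⟨ periodic-* S-period-N y a ⟩
    S a                  ∎

  S-const : ∀ a → S a ≡ S 0
  S-const zero    = refl
  S-const (suc a) = trans (S-suc a) (S-const a)

  Σ-progression : .{{NonZero N}} → ∀ a → S a ≡ Σ< N R
  Σ-progression a = trans (S-const a) (*-cancelˡ-≡ _ _ N (begin-equality
    N * S 0                                  ≡⟨ Σ-const N (S 0) ⟨
    Σ< N (λ _ → S 0)                         ≡⟨ Σ-cong N S-const ⟨
    Σ< N S                                   ≡⟨ Σ-comm N N (λ a b → R (b * M + a)) ⟩
    Σ< N (λ b → Σ< N (λ a → R (b * M + a)))  ≡⟨ Σ-cong N (λ b → trans (Σ-cong N λ a → cong R (+-comm (b * M) a)) (Σ-shift perR (b * M))) ⟩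
    Σ< N (λ _ → Σ< N R)                      ≡⟨ Σ-const N _ ⟩
    N * Σ< N R                               ∎))

open Progression using (Σ-progression)

-- The Chinese remainder theorem as a factorisation of sums

-- Write `y = b * M + a`. Then `Q` sees only `a`, and for fixed `a` the argument of `R` runs through
-- a progression of step `M`, which meets every residue mod `N` once. No bijection of residues has
-- to be constructed.
Σ-coprime : ∀ {M N} {Q R : ℕ → ℕ} → Coprime M N → .{{NonZero N}} → Periodic M Q → Periodic N R →
            Σ< (N * M) (λ y → R y * Q y) ≡ Σ< N R * Σ< M Q
Σ-coprime {M} {N} {Q} {R} cop perQ perR = begin-equality
  Σ< (N * M) (λ y → R y * Q y)
    ≡⟨ Σ-blocks N M _ ⟩
  Σ< N (λ b → Σ< M (λ a → R (b * M + a) * Q (b * M + a)))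
    ≡⟨ Σ-cong N (λ b → Σ-cong M λ a → trans (cong (R (b * M + a) *_) (periodic-* perQ b a)) (*-comm _ (Q a))) ⟩
  Σ< N (λ b → Σ< M (λ a → Q a * R (b * M + a)))
    ≡⟨ Σ-comm N M _ ⟩
  Σ< M (λ a → Σ< N (λ b → Q a * R (b * M + a)))
    ≡⟨ Σ-cong M (λ a → trans (Σ-distribˡ-* N (Q a) _) (trans (cong (Q a *_) (Σ-progression cop perR a)) (*-comm (Q a) _))) ⟩
  Σ< M (λ a → Σ< N R * Q a)
    ≡⟨ Σ-distribˡ-* M (Σ< N R) Q ⟩
  Σ< N R * Σ< M Q ∎

coprime-* : ∀ {a b c} → Coprime a b → Coprime a c → Coprime a (b * c)
coprime-* cab cac (d∣a , d∣bc) =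
  cac (d∣a , coprime-divisor (λ (e∣d , e∣b) → cab (∣-trans e∣d d∣a , e∣b)) d∣bc)

coprime-∏ : ∀ {r a} (P : Fin r → ℕ) → (∀ i → Coprime a (P i)) → Coprime a (∏ P)
coprime-∏ {zero}  P cop = coprime-sym (1-coprimeTo _)
coprime-∏ {suc r} P cop = coprime-* (cop zero) (coprime-∏ (P ∘ suc) (cop ∘ suc))

∣-∏ : ∀ {r} (P : Fin r → ℕ) i → P i ∣ ∏ P
∣-∏ P zero    = m∣m*n _
∣-∏ P (suc i) = ∣n⇒∣m*n (P zero) (∣-∏ (P ∘ suc) i)

∏-cong : ∀ {r} {f g : Fin r → ℕ} → (∀ i → f i ≡ g i) → ∏ f ≡ ∏ g
∏-cong {zero}  eq = refl
∏-cong {suc r} eq = cong₂ _*_ (eq zero) (∏-cong (eq ∘ suc))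

PairwiseCoprime : ∀ {r} → (Fin r → ℕ) → Set
PairwiseCoprime P = ∀ i j → i ≢ j → Coprime (P i) (P j)

Σ-∏ : ∀ {r} {P : Fin r → ℕ} {h : Fin r → ℕ → ℕ} → PairwiseCoprime P → (∀ i → NonZero (P i)) →
      (∀ i → Periodic (P i) (h i)) → Σ< (∏ P) (λ y → ∏ (λ i → h i y)) ≡ ∏ (λ i → Σ< (P i) (h i))
Σ-∏ {zero}          cop nz per = refl
Σ-∏ {suc r} {P} {h} cop nz per = trans
  (Σ-coprime {Q = λ y → ∏ (λ i → h (suc i) y)}
    (coprime-sym (coprime-∏ (P ∘ suc) λ i → cop zero (suc i) λ ()))
    {{nz zero}}
    (λ y → ∏-cong λ i → periodic-multiple (∣-∏ (P ∘ suc) i) (per (suc i)) y)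
    (per zero))
  (cong (Σ< (P zero) (h zero) *_)
    (Σ-∏ (λ i j i≢j → cop (suc i) (suc j) λ { refl → i≢j refl }) (nz ∘ suc) (per ∘ suc)))

-- Indicators and counting

⟦_⟧ : Bool → ℕ
⟦ b ⟧ = if b then 1 else 0

𝟙 : ∀ {A : Set} → Dec A → ℕ
𝟙 d = ⟦ does d ⟧

𝟙-cong : ∀ {A B : Set} (d : Dec A) (e : Dec B) → (A → B) → (B → A) → 𝟙 d ≡ 𝟙 e
𝟙-cong d e f g = cong ⟦_⟧ (does-⇔ (mk⇔ f g) d e)

⟦⟧-∧ : ∀ a b → ⟦ a ∧ b ⟧ ≡ ⟦ a ⟧ * ⟦ b ⟧
⟦⟧-∧ true  b = sym (+-identityʳ ⟦ b ⟧)
⟦⟧-∧ false b = refl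

𝟙-yes : ∀ {A : Set} (d : Dec A) → A → 𝟙 d ≡ 1
𝟙-yes d a = cong ⟦_⟧ (dec-true d a)

𝟙-no : ∀ {A : Set} (d : Dec A) → ¬ A → 𝟙 d ≡ 0
𝟙-no d ¬a = cong ⟦_⟧ (dec-false d ¬a)

𝟙-∀ : ∀ {r} {A : Fin r → Set} (d : ∀ i → Dec (A i)) → 𝟙 (all? d) ≡ ∏ (λ i → 𝟙 (d i))
𝟙-∀ {zero}  d = 𝟙-yes (all? d) λ ()
𝟙-∀ {suc r} d = begin-equality
  𝟙 (all? d)                           ≡⟨ 𝟙-cong (all? d) (d zero ×-dec all? (d ∘ suc))
                                            (λ f → f zero , λ i → f (suc i))
                                            (λ { (a , f) zero → a ; (a , f) (suc i) → f i }) ⟩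
  𝟙 (d zero ×-dec all? (d ∘ suc))      ≡⟨ ⟦⟧-∧ (does (d zero)) _ ⟩
  𝟙 (d zero) * 𝟙 (all? (d ∘ suc))      ≡⟨ cong (𝟙 (d zero) *_) (𝟙-∀ (d ∘ suc)) ⟩
  𝟙 (d zero) * ∏ (λ i → 𝟙 (d (suc i))) ∎

𝟙-∏ : ∀ {r} {A : Fin r → Set} {B : Set} (e : Dec B) (d : ∀ i → Dec (A i)) →
      (B → ∀ i → A i) → ((∀ i → A i) → B) → 𝟙 e ≡ ∏ (λ i → 𝟙 (d i))
𝟙-∏ e d f g = trans (𝟙-cong e (all? d) f g) (𝟙-∀ d)

length-filterᵇ-tabulate : ∀ {A : Set} {n} (Q : A → Bool) (f : Fin n → A) (h : ℕ → ℕ) →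
  (∀ i → ⟦ Q (f i) ⟧ ≡ h (toℕ i)) → length (filterᵇ Q (tabulate f)) ≡ Σ< n h
length-filterᵇ-tabulate {n = zero}  Q f h eq = refl
length-filterᵇ-tabulate {n = suc n} Q f h eq
  with Q (f zero) | eq zero | length-filterᵇ-tabulate Q (f ∘ suc) (h ∘ suc) (eq ∘ suc)
... | true  | e | ih = cong₂ _+_ e ih
... | false | e | ih = cong₂ _+_ e ih

length-filterᵇ-applyUpTo : ∀ (Q : ℕ → Bool) (f : ℕ → ℕ) n →
  length (filterᵇ Q (map suc (applyUpTo f n))) ≡ Σ< n (λ y → ⟦ Q (suc (f y)) ⟧)
length-filterᵇ-applyUpTo Q f zero = refl
length-filterᵇ-applyUpTo Q f (suc n) with Q (suc (f 0)) | length-filterᵇ-applyUpTo Q (f ∘ suc) n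
... | true  | ih = cong suc ih
... | false | ih = ih

-- Divisibility by gcds, one prime power at a time

coprime-∣* : ∀ {a b y} → Coprime a b → a ∣ y → b ∣ y → a * b ∣ y
coprime-∣* {a} {b} cop (divides q refl) b∣qa = subst (_∣ q * a) (*-comm b a)
  (*-monoˡ-∣ a (coprime-divisor {b} {a} (coprime-sym cop) (subst (b ∣_) (*-comm q a) b∣qa)))

coprime-∣ : ∀ {a b c d} → c ∣ a → d ∣ b → Coprime a b → Coprime c d
coprime-∣ c∣a d∣b cop (e∣c , e∣d) = cop (∣-trans e∣c c∣a , ∣-trans e∣d d∣b)

-- Multiplied out, the right side is the gcd of multiples of `x` and of `a * b`, all of which the
-- left side divides.
gcd-*-∣ : ∀ x a b → gcd x (a * b) ∣ gcd x a * gcd x b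
gcd-*-∣ x a b = subst (gcd x (a * b) ∣_) (sym (c*gcd[m,n]≡gcd[cm,cn] (gcd x a) x b))
  (gcd-greatest (∣n⇒∣m*n (gcd x a) (gcd[m,n]∣m x (a * b)))
    (subst (gcd x (a * b) ∣_) (trans (sym (c*gcd[m,n]≡gcd[cm,cn] b x a)) (*-comm b (gcd x a)))
      (gcd-greatest (∣n⇒∣m*n b (gcd[m,n]∣m x (a * b)))
                    (subst (gcd x (a * b) ∣_) (*-comm a b) (gcd[m,n]∣n x (a * b))))))

-- The local gcds are pairwise coprime, so their product divides `y` once each of them does.
-- Together with `∣-∏⇒gcd-∣` this turns membership in a cyclic subgroup into a separate condition at
-- each factor.
gcd-∏-∣ : ∀ {r} {P : Fin r → ℕ} → PairwiseCoprime P → ∀ x {y} →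
          (∀ i → gcd x (P i) ∣ y) → gcd x (∏ P) ∣ y
gcd-∏-∣ {zero} cop x g∣y = ∣-trans (gcd[m,n]∣n x 1) (1∣ _)
gcd-∏-∣ {suc r} {P} cop x g∣y = ∣-trans (gcd-*-∣ x (P zero) (∏ (P ∘ suc)))
  (coprime-∣*
    (coprime-∣ (gcd[m,n]∣n x (P zero)) (gcd[m,n]∣n x (∏ (P ∘ suc)))
      (coprime-∏ (P ∘ suc) λ i → cop zero (suc i) λ ()))
    (g∣y zero)
    (gcd-∏-∣ (λ i j i≢j → cop (suc i) (suc j) λ { refl → i≢j refl }) x (g∣y ∘ suc)))

∣-∏⇒gcd-∣ : ∀ {r} (P : Fin r → ℕ) x {y} → gcd x (∏ P) ∣ y → ∀ i → gcd x (P i) ∣ y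
∣-∏⇒gcd-∣ P x g∣y i = ∣-trans
  (gcd-greatest (gcd[m,n]∣m x (P i)) (∣-trans (gcd[m,n]∣n x (P i)) (∣-∏ P i))) g∣y

-- Counting multiples, and the totient of a squarefree number

gcd-+ : ∀ m x → gcd (m + x) m ≡ gcd x m
gcd-+ m x = ∣-antisym
  (gcd-greatest (∣m+n∣m⇒∣n (gcd[m,n]∣m (m + x) m) (gcd[m,n]∣n (m + x) m)) (gcd[m,n]∣n (m + x) m))
  (gcd-greatest (∣m∣n⇒∣m+n (gcd[m,n]∣n x m) (gcd[m,n]∣m x m)) (gcd[m,n]∣n x m))

∣-periodic : ∀ {d m} → d ∣ m → Periodic m (λ y → 𝟙 (d ∣? y))
∣-periodic {d} {m} d∣m y =
  𝟙-cong (d ∣? (m + y)) (d ∣? y) (λ d∣m+y → ∣m+n∣m⇒∣n d∣m+y d∣m) (∣m∣n⇒∣m+n d∣m)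

Σ-multiples : ∀ q d .{{_ : NonZero d}} → Σ< (q * d) (λ y → 𝟙 (d ∣? y)) ≡ q
Σ-multiples q d@(suc d′) = begin-equality
  Σ< (q * d) (λ y → 𝟙 (d ∣? y))
    ≡⟨ Σ-blocks q d _ ⟩
  Σ< q (λ b → Σ< d (λ a → 𝟙 (d ∣? (b * d + a))))
    ≡⟨ Σ-cong q (λ b → Σ-cong d (periodic-* (∣-periodic {d} ∣-refl) b)) ⟩
  Σ< q (λ _ → Σ< d (λ y → 𝟙 (d ∣? y)))
    ≡⟨ Σ-cong q (λ _ → oneMultiple) ⟩
  Σ< q (λ _ → 1)
    ≡⟨ trans (Σ-const q 1) (*-identityʳ q) ⟩
  q ∎
  where
  oneMultiple : Σ< d (λ y → 𝟙 (d ∣? y)) ≡ 1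
  oneMultiple = cong₂ _+_ (𝟙-yes (d ∣? 0) (d ∣0))
    (trans (Σ-cong< d′ λ y y<d′ → 𝟙-no (d ∣? suc y) (λ h → <⇒≱ (s≤s y<d′) (∣⇒≤ h)))
           (trans (Σ-const d′ 0) (*-zeroʳ d′)))

Σ-complement : ∀ m (f g : ℕ → ℕ) → (∀ y → f y + g y ≡ 1) → Σ< m f + Σ< m g ≡ m
Σ-complement m f g eq = begin-equality
  Σ< m f + Σ< m g            ≡⟨ Σ-distrib-+ m f g ⟨
  Σ< m (λ y → f y + g y)     ≡⟨ Σ-cong m eq ⟩
  Σ< m (λ _ → 1)             ≡⟨ trans (Σ-const m 1) (*-identityʳ m) ⟩
  m                          ∎

𝟙-¬ : ∀ {A : Set} (d : Dec A) → 𝟙 (¬? d) + 𝟙 d ≡ 1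
𝟙-¬ (yes _) = refl
𝟙-¬ (no _)  = refl

gcd-prime-∣1 : ∀ {p} → Prime p → ∀ {y} → ¬ p ∣ y → gcd y p ∣ 1
gcd-prime-∣1 {p} pp {y} p∤y with prime⇒irreducible pp (gcd[m,n]∣n y p)
... | inj₁ eq = subst (_∣ 1) (sym eq) ∣-refl
... | inj₂ eq = contradiction (subst (_∣ y) eq (gcd[m,n]∣m y p)) p∤y

prime∤1 : ∀ {p} → Prime p → ¬ p ∣ 1
prime∤1 pp p∣1 = nonTrivial⇒≢1 {{prime⇒nonTrivial pp}} (∣1⇒≡1 p∣1)

-- Periodicity moves the count from 1, ..., n to 0, ..., n - 1. Coprimality to `∏ p` is then a
-- product of the indicators of `p i ∤ y`, and `Σ-∏` factorises the count.
φ-∏ : ∀ {r} {p : Fin r → ℕ} → (∀ i → Prime (p i)) → PairwiseCoprime p →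
      φ (∏ p) ≡ ∏ (λ i → p i ∸ 1)
φ-∏ {r} {p} pp cop = begin-equality
  φ (∏ p)
    ≡⟨ length-filterᵇ-applyUpTo (λ k → gcd k (∏ p) ≡ᵇ 1) id (∏ p) ⟩
  Σ< (∏ p) (λ y → ⟦ gcd (suc y) (∏ p) ≡ᵇ 1 ⟧)
    ≡⟨ Σ-suc {∏ p} {λ y → ⟦ gcd y (∏ p) ≡ᵇ 1 ⟧} (λ y → cong (λ g → ⟦ g ≡ᵇ 1 ⟧) (gcd-+ (∏ p) y)) ⟩
  Σ< (∏ p) (λ y → ⟦ gcd y (∏ p) ≡ᵇ 1 ⟧)
    ≡⟨ Σ-cong (∏ p) (λ y → 𝟙-∏ (gcd y (∏ p) ≟ 1) (λ i → ¬? (p i ∣? y))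
         (λ g≡1 i p∣y → prime∤1 (pp i) (subst (p i ∣_) g≡1 (gcd-greatest p∣y (∣-∏ p i))))
         (λ p∤y → ∣1⇒≡1 (gcd-∏-∣ cop y λ i → gcd-prime-∣1 (pp i) (p∤y i)))) ⟩
  Σ< (∏ p) (λ y → ∏ (λ i → 𝟙 (¬? (p i ∣? y))))
    ≡⟨ Σ-∏ {P = p} {h = λ i y → 𝟙 (¬? (p i ∣? y))} cop (λ i → prime⇒nonZero (pp i))
         (λ i y → 𝟙-cong (¬? (p i ∣? (p i + y))) (¬? (p i ∣? y))
           (λ ∤+ ∣y → ∤+ (∣m∣n⇒∣m+n ∣-refl ∣y)) (λ ∤y ∣+ → ∤y (∣m+n∣m⇒∣n ∣+ ∣-refl))) ⟩
  ∏ (λ i → Σ< (p i) (λ y → 𝟙 (¬? (p i ∣? y))))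
    ≡⟨ ∏-cong (λ i → nonMultiples (p i) {{prime⇒nonZero (pp i)}}) ⟩
  ∏ (λ i → p i ∸ 1) ∎
  where
  nonMultiples : ∀ q → .{{NonZero q}} → Σ< q (λ y → 𝟙 (¬? (q ∣? y))) ≡ q ∸ 1
  nonMultiples q = begin-equality
    Σ< q (λ y → 𝟙 (¬? (q ∣? y)))         ≡⟨ m+n∸n≡m _ 1 ⟨
    Σ< q (λ y → 𝟙 (¬? (q ∣? y))) + 1 ∸ 1 ≡⟨ cong (λ k → Σ< q (λ y → 𝟙 (¬? (q ∣? y))) + k ∸ 1)
                                              (trans (cong (λ m → Σ< m (λ y → 𝟙 (q ∣? y))) (sym (+-identityʳ q))) (Σ-multiples 1 q)) ⟨
    Σ< q (λ y → 𝟙 (¬? (q ∣? y))) + Σ< q (λ y → 𝟙 (q ∣? y)) ∸ 1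
                                         ≡⟨ cong (_∸ 1) (Σ-complement q _ _ λ y → 𝟙-¬ (q ∣? y)) ⟩
    q ∸ 1                                ∎

φ-prime : ∀ {p} → Prime p → φ p ≡ p ∸ 1
φ-prime {p} pp = begin-equality
  φ p            ≡⟨ cong φ (*-identityʳ p) ⟨
  φ (p * 1)      ≡⟨ φ-∏ {1} {λ _ → p} (λ _ → pp) (λ { zero zero 0≢0 → contradiction refl 0≢0 }) ⟩
  (p ∸ 1) * 1    ≡⟨ *-identityʳ _ ⟩
  p ∸ 1          ∎

-- Powers in a cyclic group as divisibility by a gcd

-- Multiples of the modulus are allowed on both sides, so that either sign of a Bézout identity can
-- be used without subtraction. The multiplier `k` is reduced into the range that `isPowerOf`
-- searches.
isPowerOf⁺ : ∀ {m} (b a : Fin (suc m)) k u v →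
             k * toℕ a + u * suc m ≡ toℕ b + v * suc m → T (isPowerOf b a)
isPowerOf⁺ {m} b a k u v eq = any⁺ _ (lose (∈-allFin (fromℕ< (m%n<n k n)))
  (≡⇒≡ᵇ _ (toℕ b) (begin-equality
    (toℕ (fromℕ< (m%n<n k n)) * toℕ a) % n  ≡⟨ cong (λ z → (z * toℕ a) % n) (toℕ-fromℕ< (m%n<n k n)) ⟩
    ((k % n) * toℕ a) % n                   ≡⟨ %-distribˡ-* (k % n) (toℕ a) n ⟩
    ((k % n % n) * (toℕ a % n)) % n         ≡⟨ cong (λ z → (z * (toℕ a % n)) % n) (m%n%n≡m%n k n) ⟩
    ((k % n) * (toℕ a % n)) % n             ≡⟨ %-distribˡ-* k (toℕ a) n ⟨
    (k * toℕ a) % n                         ≡⟨ [m+kn]%n≡m%n (k * toℕ a) u n ⟨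
    (k * toℕ a + u * n) % n                 ≡⟨ cong (_% n) eq ⟩
    (toℕ b + v * n) % n                     ≡⟨ [m+kn]%n≡m%n (toℕ b) v n ⟩
    toℕ b % n                               ≡⟨ m<n⇒m%n≡m (toℕ<n b) ⟩
    toℕ b                                   ∎)))
  where n = suc m

gcd∣⇒isPowerOf : ∀ {m} (b a : Fin (suc m)) → gcd (toℕ a) (suc m) ∣ toℕ b → T (isPowerOf b a)
gcd∣⇒isPowerOf {m} b a (divides q b≡qd) with Bézout.identity (gcd-GCD (toℕ a) (suc m))
... | Bézout.+- x y eq = isPowerOf⁺ b a (q * x) 0 (q * y) (begin-equality
  q * x * toℕ a + 0                 ≡⟨ trans (+-identityʳ _) (*-assoc q x _) ⟩
  q * (x * toℕ a)                   ≡⟨ cong (q *_) eq ⟨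
  q * (d + y * suc m)               ≡⟨ trans (*-distribˡ-+ q d _) (cong₂ _+_ (sym b≡qd) (sym (*-assoc q y _))) ⟩
  toℕ b + q * y * suc m             ∎)
  where d = gcd (toℕ a) (suc m)
-- Here `d` is congruent to `− x * a` modulo `suc m`; the factor `m`, congruent to -1, supplies the
-- sign.
... | Bézout.-+ x y eq = isPowerOf⁺ b a (q * x * m) (q * y) (q * x * toℕ a) (begin-equality
  q * x * m * toℕ a + q * y * suc m          ≡⟨ cong (q * x * m * toℕ a +_) (*-assoc q y _) ⟩
  q * x * m * toℕ a + q * (y * suc m)        ≡⟨ cong (λ z → q * x * m * toℕ a + q * z) eq ⟨
  q * x * m * toℕ a + q * (d + x * toℕ a)    ≡⟨ rearrange q x m (toℕ a) d ⟩
  q * d + q * x * toℕ a * suc m              ≡⟨ cong (_+ q * x * toℕ a * suc m) b≡qd ⟨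
  toℕ b + q * x * toℕ a * suc m              ∎)
  where
  d = gcd (toℕ a) (suc m)
  rearrange : ∀ q x m a d → q * x * m * a + q * (d + x * a) ≡ q * d + q * x * a * (1 + m)
  rearrange = solve-∀

isPowerOf⇒gcd∣ : ∀ {m} (b a : Fin (suc m)) → T (isPowerOf b a) → gcd (toℕ a) (suc m) ∣ toℕ b
isPowerOf⇒gcd∣ {m} b a t with find (any⁻ _ (allFin (suc m)) t)
... | k , _ , eq = subst (gcd (toℕ a) (suc m) ∣_) (≡ᵇ⇒≡ _ (toℕ b) eq)
  (%-presˡ-∣ (∣n⇒∣m*n (toℕ k) (gcd[m,n]∣m (toℕ a) (suc m))) (gcd[m,n]∣n (toℕ a) (suc m)))

isPowerOf-does : ∀ {m} (b a : Fin (suc m)) → isPowerOf b a ≡ does (gcd (toℕ a) (suc m) ∣? toℕ b)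
isPowerOf-does b a =
  does-⇔ (mk⇔ (isPowerOf⇒gcd∣ b a) (gcd∣⇒isPowerOf b a)) (T? (isPowerOf b a)) (_ ∣? _)

-- The degree by inclusion-exclusion

Σ-≡ᵇ : ∀ {n x} → x < n → Σ< n (λ y → ⟦ x ≡ᵇ y ⟧) ≡ 1
Σ-≡ᵇ {suc n} {zero}  _         = cong suc (trans (Σ-const n 0) (*-zeroʳ n))
Σ-≡ᵇ {suc n} {suc x} (s≤s x<n) = Σ-≡ᵇ x<n

module _ {n : ℕ} (x : ℕ) where

  -- The indicators of y ∈ ⟨x⟩ and of x ∈ ⟨y⟩ in ℤ_n.
  below above : ℕ → ℕ
  below y = 𝟙 (gcd x n ∣? y)
  above y = 𝟙 (gcd y n ∣? x)

  adjacentℕ : ℕ → Bool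
  adjacentℕ y = not (x ≡ᵇ y) ∧ (does (gcd y n ∣? x) ∨ does (gcd x n ∣? y))

  -- On the diagonal both indicators are 1 while adjacency fails, which accounts for the extra
  -- `⟦ x ≡ᵇ y ⟧`; summed over `y` it becomes the `1 +` of `deg-Σ`.
  inclusion-exclusion : ∀ y →
    ⟦ adjacentℕ y ⟧ + (⟦ x ≡ᵇ y ⟧ + below y * above y) ≡ below y + above y
  inclusion-exclusion y with x ≡ᵇ y in eq
  ... | true  rewrite sym (≡ᵇ⇒≡ x y (subst T (sym eq) _))
                    | 𝟙-yes (gcd x n ∣? x) (gcd[m,n]∣m x n) = refl
  ... | false with does (gcd y n ∣? x) | does (gcd x n ∣? y)
  ...   | true  | true  = refl
  ...   | true  | false = refl
  ...   | false | true  = refl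
  ...   | false | false = refl

deg-Σ : ∀ {n} (a : Fin n) → let x = toℕ a in
        deg a + (1 + Σ< n (λ y → below {n} x y * above {n} x y)) ≡ Σ< n (below {n} x) + Σ< n (above {n} x)
deg-Σ {n@(suc m)} a = begin-equality
  deg a + (1 + Σ< n (λ y → B y * A y))
    ≡⟨ cong₂ (λ u v → u + (v + Σ< n (λ y → B y * A y)))
         (length-filterᵇ-tabulate (adjacent a) id (λ y → ⟦ adjacentℕ {n} x y ⟧)
           (λ b → cong₂ (λ u v → ⟦ not (x ≡ᵇ toℕ b) ∧ (u ∨ v) ⟧) (isPowerOf-does a b) (isPowerOf-does b a)))
         (sym (Σ-≡ᵇ (toℕ<n a))) ⟩
  Σ< n (λ y → ⟦ adjacentℕ {n} x y ⟧) + (Σ< n (λ y → ⟦ x ≡ᵇ y ⟧) + Σ< n (λ y → B y * A y))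
    ≡⟨ cong (Σ< n (λ y → ⟦ adjacentℕ {n} x y ⟧) +_) (Σ-distrib-+ n (λ y → ⟦ x ≡ᵇ y ⟧) (λ y → B y * A y)) ⟨
  Σ< n (λ y → ⟦ adjacentℕ {n} x y ⟧) + Σ< n (λ y → ⟦ x ≡ᵇ y ⟧ + B y * A y)
    ≡⟨ Σ-distrib-+ n (λ y → ⟦ adjacentℕ {n} x y ⟧) (λ y → ⟦ x ≡ᵇ y ⟧ + B y * A y) ⟨
  Σ< n (λ y → ⟦ adjacentℕ {n} x y ⟧ + (⟦ x ≡ᵇ y ⟧ + B y * A y))
    ≡⟨ Σ-cong n (inclusion-exclusion {n} x) ⟩
  Σ< n (λ y → B y + A y)
    ≡⟨ Σ-distrib-+ n B A ⟩
  Σ< n B + Σ< n A ∎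
  where
  x = toℕ a
  B = below {n} x
  A = above {n} x

module _ {r : ℕ} {P : Fin r → ℕ} (cop : PairwiseCoprime P) (nz : ∀ i → NonZero (P i)) (x : ℕ) where

  private
    below-∏ : ∀ y → below {∏ P} x y ≡ ∏ (λ i → below {P i} x y)
    below-∏ y = 𝟙-∏ (gcd x (∏ P) ∣? y) (λ i → gcd x (P i) ∣? y) (∣-∏⇒gcd-∣ P x) (gcd-∏-∣ cop x)

    above-∏ : ∀ y → above {∏ P} x y ≡ ∏ (λ i → above {P i} x y)
    above-∏ y = 𝟙-∏ (gcd y (∏ P) ∣? x) (λ i → gcd y (P i) ∣? x) (∣-∏⇒gcd-∣ P y) (gcd-∏-∣ cop y)

    below-periodic : ∀ m → Periodic m (below {m} x)
    below-periodic m = ∣-periodic (gcd[m,n]∣n x m)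

    above-periodic : ∀ m → Periodic m (above {m} x)
    above-periodic m y = cong (λ g → 𝟙 (g ∣? x)) (gcd-+ m y)

  Σ-below : Σ< (∏ P) (below {∏ P} x) ≡ ∏ (λ i → Σ< (P i) (below {P i} x))
  Σ-below = trans (Σ-cong (∏ P) below-∏) (Σ-∏ cop nz λ i → below-periodic (P i))

  Σ-above : Σ< (∏ P) (above {∏ P} x) ≡ ∏ (λ i → Σ< (P i) (above {P i} x))
  Σ-above = trans (Σ-cong (∏ P) above-∏) (Σ-∏ cop nz λ i → above-periodic (P i))

  Σ-below*above : Σ< (∏ P) (λ y → below {∏ P} x y * above {∏ P} x y) ≡
                  ∏ (λ i → Σ< (P i) (λ y → below {P i} x y * above {P i} x y))
  Σ-below*above = trans
    (Σ-cong (∏ P) λ y → trans (cong₂ _*_ (below-∏ y) (above-∏ y))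
      (sym (∏-distrib-* (λ i → below {P i} x y) (λ i → above {P i} x y))))
    (Σ-∏ cop nz λ i y → cong₂ _*_ (below-periodic (P i) y) (above-periodic (P i) y))

deg-∏ : ∀ {r} {P : Fin r → ℕ} → PairwiseCoprime P → (∀ i → NonZero (P i)) →
  ∀ {n} → n ≡ ∏ P → (a : Fin n) → let x = toℕ a in
  deg a + (1 + ∏ (λ i → Σ< (P i) (λ y → below {P i} x y * above {P i} x y))) ≡
  ∏ (λ i → Σ< (P i) (below {P i} x)) + ∏ (λ i → Σ< (P i) (above {P i} x))
deg-∏ cop nz refl a = trans (cong (λ z → deg a + (1 + z)) (sym (Σ-below*above cop nz (toℕ a))))
  (trans (deg-Σ a) (cong₂ _+_ (Σ-below cop nz (toℕ a)) (Σ-above cop nz (toℕ a))))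

-- Counts modulo a prime power

prime∤⇒coprime : ∀ {p d} → Prime p → ¬ p ∣ d → Coprime d p
prime∤⇒coprime pp p∤d (e∣d , e∣p) with prime⇒irreducible pp e∣p
... | inj₁ e≡1 = e≡1
... | inj₂ refl = contradiction e∣d p∤d

-- The complementary exponent `e` is returned as well: in `localCount`, whether it is zero separates
-- the residue 0 from all others.
∣-prime-power : ∀ {p} → Prime p → ∀ a {d} → d ∣ p ^ a → ∃[ b ] ∃[ e ] b + e ≡ a × d ≡ p ^ b
∣-prime-power pp zero d∣1 = 0 , 0 , refl , ∣1⇒≡1 d∣1
∣-prime-power {p} pp (suc a) {d} d∣p^ with p ∣? d
... | yes (divides d′ refl) =
  let b , e , b+e≡a , d′≡p^b = ∣-prime-power pp a
        (*-cancelˡ-∣ p {{prime⇒nonZero pp}} (subst (_∣ p * p ^ a) (*-comm d′ p) d∣p^))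
  in suc b , e , cong suc b+e≡a , trans (*-comm d′ p) (cong (p *_) d′≡p^b)
... | no p∤d =
  let b , e , b+e≡a , d≡p^b = ∣-prime-power pp a (coprime-divisor (prime∤⇒coprime pp p∤d) d∣p^)
  in b , suc e , trans (+-suc b e) (cong suc b+e≡a) , d≡p^b

^-monoʳ-∣ : ∀ p {b c} → b ≤ c → p ^ b ∣ p ^ c
^-monoʳ-∣ p {b} {c} b≤c = subst (p ^ b ∣_)
  (trans (sym (^-distribˡ-+-* p b (c ∸ b))) (cong (p ^_) (m+[n∸m]≡n b≤c))) (m∣m*n _)

-- w counts the y mod P with gcd(x, P) a proper divisor of gcd(y, P).
record LocalCount (p P x : ℕ) : Set where
  field
    u w         : ℕ
    Σ-below≡    : Σ< P (below {P} x) ≡ u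
    Σ-above+    : Σ< P (above {P} x) + w ≡ P
    Σ-both+     : Σ< P (λ y → below {P} x y * above {P} x y) + w ≡ u
    p*w≤u       : p * w ≤ u
    1≤u         : 1 ≤ u
    gcd≡1⇒      : gcd x P ≡ 1 → u ≡ P × p * w ≡ u
    gcd≢1⇒      : gcd x P ≢ 1 → p * u ≤ P
    gcd≡P⇒      : gcd x P ≡ P → u ≡ 1 × w ≡ 0

module _ {p : ℕ} (pp : Prime p) where

  private
    instance
      nzp : NonZero p
      nzp = prime⇒nonZero pp

    1<p : 1 < p
    1<p = nonTrivial⇒n>1 p {{prime⇒nonTrivial pp}}

    ^-nz : ∀ a → NonZero (p ^ a)
    ^-nz a = m^n≢0 p a

    p≤p^ : ∀ b → p ^ b ≢ 1 → p ≤ p ^ b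
    p≤p^ zero    1≢1 = contradiction refl 1≢1
    p≤p^ (suc b) _   = m≤m*n p (p ^ b) {{^-nz b}}

  -- No divisor of `P` is a proper multiple of `P`, so `w = 0`. This is the one case in which
  -- `p * w` differs from `u`.
  localCount-full : ∀ P x .{{_ : NonZero P}} → p ≤ P → gcd x P ≡ P → LocalCount p P x
  localCount-full P x p≤P d≡P = record
    { u = 1 ; w = 0
    ; Σ-below≡ = Σb
    ; Σ-above+ = trans (+-identityʳ _) (trans (Σ-cong P A≡1) (trans (Σ-const P 1) (*-identityʳ P)))
    ; Σ-both+ = trans (+-identityʳ _)
        (trans (Σ-cong P λ y → trans (cong (below {P} x y *_) (A≡1 y)) (*-identityʳ _)) Σb)
    ; p*w≤u = ≤-trans (≤-reflexive (*-zeroʳ p)) z≤n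
    ; 1≤u = s≤s z≤n
    ; gcd≡1⇒ = λ d≡1 → contradiction (subst (1 <_) (trans (sym d≡P) d≡1) (≤-trans 1<p p≤P)) (n≮n 1)
    ; gcd≢1⇒ = λ _ → ≤-trans (≤-reflexive (*-identityʳ p)) p≤P
    ; gcd≡P⇒ = λ _ → refl , refl
    }
    where
    Σb : Σ< P (below {P} x) ≡ 1
    Σb = trans (cong (λ d → Σ< P (λ y → 𝟙 (d ∣? y))) d≡P)
      (trans (cong (λ m → Σ< m (λ y → 𝟙 (P ∣? y))) (sym (*-identityˡ P))) (Σ-multiples 1 P))
    A≡1 : ∀ y → above {P} x y ≡ 1
    A≡1 y = 𝟙-yes (gcd y P ∣? x) (∣-trans (gcd[m,n]∣n y P) (subst (_∣ x) d≡P (gcd[m,n]∣m x P)))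

  -- The condition `gcd y P ∣ x` fails exactly for the multiples `y` of `p ^ suc b`, and these all
  -- satisfy `gcd x P ∣ y`. So the same number `p ^ e` is missing from the count of `above` and from
  -- the count of both relations.
  localCount-proper : ∀ b e x → let P = p ^ (b + suc e) in gcd x P ≡ p ^ b → LocalCount p P x
  localCount-proper b e x d≡ = record
    { u = p ^ suc e ; w = p ^ e
    ; Σ-below≡ = Σb
    ; Σ-above+ = trans (cong (Σ< P (above {P} x) +_) (sym Σw)) (Σ-complement P _ _ A+w)
    ; Σ-both+ = trans (cong (Σ< P (λ y → below {P} x y * above {P} x y) +_) (sym Σw))
        (trans (sym (Σ-distrib-+ P _ _)) (trans (Σ-cong P BA+w) Σb))
    ; p*w≤u = ≤-refl
    ; 1≤u = >-nonZero⁻¹ (p ^ suc e) {{^-nz (suc e)}}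
    ; gcd≡1⇒ = λ d≡1 → sym (trans P≡ (trans (cong (p ^ suc e *_) (trans (sym d≡) d≡1)) (*-identityʳ _))) , refl
    ; gcd≢1⇒ = λ d≢1 → ≤-trans (≤-reflexive (*-comm p (p ^ suc e)))
        (≤-trans (*-monoʳ-≤ (p ^ suc e) (p≤p^ b (λ p^b≡1 → d≢1 (trans d≡ p^b≡1)))) (≤-reflexive (sym P≡)))
    ; gcd≡P⇒ = λ d≡P → contradiction (trans (sym d≡) d≡P) (<⇒≢ (^-monoʳ-< p 1<p (m<m+n b (s≤s z≤n))))
    }
    where
    P = p ^ (b + suc e)
    P≡ : P ≡ p ^ suc e * p ^ b
    P≡ = trans (^-distribˡ-+-* p b (suc e)) (*-comm (p ^ b) (p ^ suc e))
    P≡′ : P ≡ p ^ e * p ^ suc b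
    P≡′ = trans (cong (p ^_) (trans (+-suc b e) (cong suc (+-comm b e))))
      (trans (cong (p ^_) (sym (+-suc e b))) (^-distribˡ-+-* p e (suc b)))
    Σb : Σ< P (below {P} x) ≡ p ^ suc e
    Σb = trans (cong₂ (λ d m → Σ< m (λ y → 𝟙 (d ∣? y))) d≡ P≡)
      (Σ-multiples (p ^ suc e) (p ^ b) {{^-nz b}})
    Σw : Σ< P (λ y → 𝟙 (p ^ suc b ∣? y)) ≡ p ^ e
    Σw = trans (cong (λ m → Σ< m (λ y → 𝟙 (p ^ suc b ∣? y))) P≡′) (Σ-multiples (p ^ e) (p ^ suc b) {{^-nz (suc b)}})
    ∤x : ∀ {y} → p ^ suc b ∣ y → ¬ gcd y P ∣ x
    ∤x {y} q∣y g∣x = <⇒≱ (^-monoʳ-< p 1<p (n<1+n b)) (∣⇒≤ {{^-nz b}}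
      (subst (p ^ suc b ∣_) d≡ (gcd-greatest (∣-trans (gcd-greatest q∣y q∣P) g∣x) q∣P)))
      where
      q∣P : p ^ suc b ∣ P
      q∣P = subst (p ^ suc b ∣_) (sym P≡′) (n∣m*n (p ^ e))
    ∣x : ∀ {y} → ¬ p ^ suc b ∣ y → gcd y P ∣ x
    ∣x {y} q∤y with ∣-prime-power pp (b + suc e) (gcd[m,n]∣n y P)
    ... | c , _ , _ , g≡ with c ≤? b
    ...   | yes c≤b = subst (_∣ x) (sym g≡) (∣-trans (^-monoʳ-∣ p c≤b) (subst (_∣ x) d≡ (gcd[m,n]∣m x P)))
    ...   | no  c≰b = contradiction (∣-trans (^-monoʳ-∣ p (≰⇒> c≰b)) (subst (_∣ y) g≡ (gcd[m,n]∣m y P))) q∤y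
    A≡ : ∀ y → above {P} x y ≡ 𝟙 (¬? (p ^ suc b ∣? y))
    A≡ y = 𝟙-cong (gcd y P ∣? x) (¬? (p ^ suc b ∣? y)) (λ g∣x q∣y → ∤x q∣y g∣x) ∣x
    A+w : ∀ y → above {P} x y + 𝟙 (p ^ suc b ∣? y) ≡ 1
    A+w y = trans (cong (_+ _) (A≡ y)) (𝟙-¬ (p ^ suc b ∣? y))
    BA+w : ∀ y → below {P} x y * above {P} x y + 𝟙 (p ^ suc b ∣? y) ≡ below {P} x y
    BA+w y with p ^ suc b ∣? y
    ... | yes q∣y = trans (cong₂ (λ s t → s * t + 1) B≡1 (𝟙-no (gcd y P ∣? x) (∤x q∣y))) (sym B≡1)
      where
      B≡1 : below {P} x y ≡ 1
      B≡1 = 𝟙-yes (gcd x P ∣? y) (subst (_∣ y) (sym d≡) (∣-trans (n∣m*n p) q∣y))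
    ... | no q∤y = trans (+-identityʳ _)
      (trans (cong (below {P} x y *_) (𝟙-yes (gcd y P ∣? x) (∣x q∤y))) (*-identityʳ _))

  localCount : ∀ a x → LocalCount p (p ^ suc a) x
  localCount a x with ∣-prime-power pp (suc a) (gcd[m,n]∣n x (p ^ suc a))
  ... | b , zero , b+0≡ , d≡ = localCount-full _ x {{^-nz (suc a)}}
    (m≤m*n p (p ^ a) {{^-nz a}})
    (trans d≡ (cong (p ^_) (trans (sym (+-identityʳ b)) b+0≡)))
  ... | b , suc e , b+e≡ , d≡ = subst (λ c → LocalCount p (p ^ c) x) b+e≡
    (localCount-proper b e x (trans (cong (λ c → gcd x (p ^ c)) b+e≡) d≡))

-- Inequalities between products

∏-mono : ∀ {r} {f g : Fin r → ℕ} → (∀ k → f k ≤ g k) → ∏ f ≤ ∏ g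
∏-mono {zero}  f≤g = ≤-refl
∏-mono {suc r} f≤g = *-mono-≤ (f≤g zero) (∏-mono (f≤g ∘ suc))

1≤∏ : ∀ {r} {f : Fin r → ℕ} → (∀ k → 1 ≤ f k) → 1 ≤ ∏ f
1≤∏ {zero}  1≤f = ≤-refl
1≤∏ {suc r} 1≤f = *-mono-≤ (1≤f zero) (1≤∏ (1≤f ∘ suc))

∏-mono-gain : ∀ {r} {f g : Fin r → ℕ} c j → (∀ k → f k ≤ g k) → c * f j ≤ g j → c * ∏ f ≤ ∏ g
∏-mono-gain {f = f} c zero f≤g gain =
  ≤-trans (≤-reflexive (sym (*-assoc c (f zero) _))) (*-mono-≤ gain (∏-mono (f≤g ∘ suc)))
∏-mono-gain {f = f} c (suc j) f≤g gain =
  ≤-trans (≤-reflexive (*-swap c (f zero) _)) (*-mono-≤ (f≤g zero) (∏-mono-gain c j (f≤g ∘ suc) gain))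

-- Each factor (1 + qₖ)/qₖ is at most (c + k + 1)/(c + k), and the product of the latter telescopes.
∏-telescope : ∀ {r} c (q : Fin r → ℕ) → (∀ k → c + toℕ k ≤ q k) → c * ∏ (suc ∘ q) ≤ (c + r) * ∏ q
∏-telescope {zero}  c q hq = ≤-reflexive (cong (_* 1) (sym (+-identityʳ c)))
∏-telescope {suc r} c q hq = *-cancelˡ-≤ (suc c) (begin
  suc c * (c * (suc q₀ * X))      ≡⟨ reorder (suc c) c (suc q₀) X ⟩
  c * suc q₀ * (suc c * X)        ≤⟨ *-mono-≤ c*[1+q₀]≤ ih ⟩
  suc c * q₀ * ((suc c + r) * Y)  ≡⟨ cong (λ s → suc c * q₀ * (s * Y)) (sym (+-suc c r)) ⟩
  suc c * q₀ * ((c + suc r) * Y)  ≡⟨ reorder′ (suc c) q₀ (c + suc r) Y ⟩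
  suc c * ((c + suc r) * (q₀ * Y)) ∎)
  where
  q₀ = q zero
  X = ∏ (suc ∘ q ∘ suc)
  Y = ∏ (q ∘ suc)
  ih : suc c * X ≤ (suc c + r) * Y
  ih = ∏-telescope (suc c) (q ∘ suc) (λ k → ≤-trans (≤-reflexive (sym (+-suc c (toℕ k)))) (hq (suc k)))
  c*[1+q₀]≤ : c * suc q₀ ≤ suc c * q₀
  c*[1+q₀]≤ = ≤-trans (≤-reflexive (*-suc c q₀))
    (+-monoˡ-≤ (c * q₀) (≤-trans (≤-reflexive (sym (+-identityʳ c))) (hq zero)))
  reorder : ∀ a b d x → a * (b * (d * x)) ≡ b * d * (a * x)
  reorder = solve-∀
  reorder′ : ∀ a b d x → a * b * (d * x) ≡ a * (d * (b * x))
  reorder′ = solve-∀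

StrictlyIncreasing : ∀ {r} → (Fin r → ℕ) → Set
StrictlyIncreasing f = ∀ i j → toℕ i < toℕ j → f i < f j

increasing⇒+toℕ≤ : ∀ {r} c (f : Fin r → ℕ) → StrictlyIncreasing f → (∀ k → c ≤ f k) → ∀ k → c + toℕ k ≤ f k
increasing⇒+toℕ≤ c f inc c≤f zero    = ≤-trans (≤-reflexive (+-identityʳ c)) (c≤f zero)
increasing⇒+toℕ≤ c f inc c≤f (suc k) = ≤-trans (≤-reflexive (+-suc c (toℕ k)))
  (increasing⇒+toℕ≤ (suc c) (f ∘ suc) (λ i j i<j → inc (suc i) (suc j) (s≤s i<j))
    (λ k → ≤-<-trans (c≤f zero) (inc zero (suc k) (s≤s z≤n))) k)

punchIn-increasing : ∀ {r} (i : Fin (suc r)) {f : Fin (suc r) → ℕ} → StrictlyIncreasing f →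
                     StrictlyIncreasing (f ∘ punchIn i)
punchIn-increasing i inc j k j<k = inc _ _ (≤∧≢⇒< (punchIn-mono-≤ i j k (<⇒≤ j<k))
  λ eq → <⇒≢ j<k (cong toℕ (punchIn-injective i j k (toℕ-injective eq))))

toℕ-punchIn≤ : ∀ {r} (i : Fin (suc r)) k → toℕ k < toℕ i → toℕ (punchIn i k) ≤ toℕ k
toℕ-punchIn≤ (suc i) zero    _         = z≤n
toℕ-punchIn≤ (suc i) (suc k) (s≤s k<i) = s≤s (toℕ-punchIn≤ i k k<i)

-- Making one local factor trivial

-- In the application `v` and `c` are the slacks `z − w` and `u − p * w`. Written with them, the two
-- sides share `base`, and what remains is `v` times the first hypothesis plus `c` times the second.
trivialise-arith : ∀ q w v c {U F G} → suc q * U ≤ F + q * G → G ≤ U →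
  suc q * (w + v) * U + q * (w + v) * F + (q * w + c) * G ≤
  (suc q * w + c) * U + (suc q * v + q * w) * F + q * (w + v) * G
trivialise-arith q w v c {U} {F} {G} pU≤ G≤U = begin
  suc q * (w + v) * U + q * (w + v) * F + (q * w + c) * G
    ≡⟨ lhs q w v c U F G ⟩
  base + (v * (suc q * U) + c * G)
    ≤⟨ +-monoʳ-≤ base (+-mono-≤ (*-monoʳ-≤ v pU≤) (*-monoʳ-≤ c G≤U)) ⟩
  base + (v * (F + q * G) + c * U)
    ≡⟨ rhs q w v c U F G ⟩
  (suc q * w + c) * U + (suc q * v + q * w) * F + q * (w + v) * G ∎
  where
  base = suc q * w * U + q * w * F + q * v * F + q * w * G
  lhs : ∀ q w v c U F G → (1 + q) * (w + v) * U + q * (w + v) * F + (q * w + c) * G ≡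
        (1 + q) * w * U + q * w * F + q * v * F + q * w * G + (v * ((1 + q) * U) + c * G)
  lhs = solve-∀
  rhs : ∀ q w v c U F G → (1 + q) * w * U + q * w * F + q * v * F + q * w * G + (v * (F + q * G) + c * U) ≡
        ((1 + q) * w + c) * U + ((1 + q) * v + q * w) * F + q * (w + v) * G
  rhs = solve-∀

-- With z = p^(α − 1) and β = min(v_p(x), α): u counts the multiples of x in ℤ_{p^α}, f the y with
-- v_p(y) ≤ β, and g the y with v_p(y) = β. Here w is u / p, except that w = 0 when β = α;
-- β itself is only needed through the distinction between β = 0 and β ≥ 1.
record Profile (p z : ℕ) : Set where
  field
    u w f g : ℕ
    f+w     : f + w ≡ p * z
    g+w     : g + w ≡ u
    p*w≤u   : p * w ≤ u
    1≤u     : 1 ≤ u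
    kind    : (u ≡ p * z × p * w ≡ u) ⊎ p * u ≤ p * z

open Profile

Trivial : ∀ {p z} → Profile p z → Set
Trivial {p} {z} π = u π ≡ p * z × p * w π ≡ u π

Nontrivial : ∀ {p z} → Profile p z → Set
Nontrivial {p} {z} π = p * u π ≤ p * z

module _ {p z q : ℕ} (p≡ : p ≡ suc q) (π : Profile p z) where

  u≤ : u π ≤ p * z
  u≤ with kind π
  ... | inj₁ (eq , _) = ≤-reflexive eq
  ... | inj₂ pu≤ = ≤-trans (m≤n*m (u π) p {{subst NonZero (sym p≡) _}}) pu≤

  g≤u : g π ≤ u π
  g≤u = m+n≤o⇒m≤o (g π) (≤-reflexive (g+w π))

  g≤f : g π ≤ f π
  g≤f = +-cancelʳ-≤ (w π) (g π) (f π) (begin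
    g π + w π ≡⟨ g+w π ⟩ u π ≤⟨ u≤ ⟩ p * z ≡⟨ f+w π ⟨ f π + w π ∎)

  -- From `P = p * z` only `w ≤ u / p ≤ P / p` is lost, so `f` keeps the share `1 − 1/p`. The bound
  -- `q*u≤p*g` is the same loss measured inside `u`.
  q*P≤p*f : q * (p * z) ≤ p * f π
  q*P≤p*f = +-cancelʳ-≤ (p * w π) _ _ (begin
    q * (p * z) + p * w π     ≤⟨ +-monoʳ-≤ (q * (p * z)) (≤-trans (p*w≤u π) u≤) ⟩
    q * (p * z) + p * z       ≡⟨ trans (+-comm (q * (p * z)) (p * z)) (cong (_* (p * z)) (sym p≡)) ⟩
    p * (p * z)               ≡⟨ cong (p *_) (f+w π) ⟨
    p * (f π + w π)           ≡⟨ *-distribˡ-+ p (f π) (w π) ⟩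
    p * f π + p * w π         ∎)

  q*u≤p*g : q * u π ≤ p * g π
  q*u≤p*g = +-cancelʳ-≤ (p * w π) _ _ (begin
    q * u π + p * w π         ≤⟨ +-monoʳ-≤ (q * u π) (p*w≤u π) ⟩
    q * u π + u π             ≡⟨ trans (+-comm (q * u π) (u π)) (cong (_* u π) (sym p≡)) ⟩
    p * u π                   ≡⟨ cong (p *_) (g+w π) ⟨
    p * (g π + w π)           ≡⟨ *-distribˡ-+ p (g π) (w π) ⟩
    p * g π + p * w π         ∎)

  trivial-w : Trivial π → w π ≡ z
  trivial-w (u≡ , pw≡) = *-cancelˡ-≡ _ _ p {{subst NonZero (sym p≡) _}} (trans pw≡ u≡)

  trivial-f : Trivial π → f π ≡ q * z
  trivial-f tr = +-cancelʳ-≡ z _ _ (trans (cong (f π +_) (sym (trivial-w tr)))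
    (trans (f+w π) (trans (cong (_* z) p≡) (+-comm z (q * z)))))

  trivial-g : Trivial π → g π ≡ q * z
  trivial-g tr = +-cancelʳ-≡ z _ _ (trans (cong (g π +_) (sym (trivial-w tr)))
    (trans (g+w π) (trans (proj₁ tr) (trans (cong (_* z) p≡) (+-comm z (q * z))))))

-- The value is linear in the triple `u`, `f`, `g` at one index, with the products `U`, `F`, `G`
-- over the other indices as coefficients. The subtracted `g` terms have changed sides.
trivialise : ∀ {p z q} → p ≡ suc q → (π π° : Profile p z) → Trivial π° → ∀ {U F G} →
  p * U ≤ F + q * G → G ≤ U → u π° * U + f π° * F + g π * G ≤ u π * U + f π * F + g π° * G
trivialise {p} {z} {q} refl π π° tr {U} {F} {G} pU≤ G≤U
  with m≤n⇒∃[o]m+o≡n (*-cancelˡ-≤ p (≤-trans (p*w≤u π) (u≤ refl π))) | m≤n⇒∃[o]m+o≡n (p*w≤u π)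
... | v , w+v≡z | c , pw+c≡u = begin
  u π° * U + f π° * F + g π * G
    ≡⟨ cong₂ _+_ (cong₂ (λ a b → a * U + b * F) (trans (proj₁ tr) (cong (p *_) (sym w+v≡z)))
                   (trans (trivial-f refl π° tr) (cong (q *_) (sym w+v≡z)))) (cong (_* G) g≡) ⟩
  suc q * (w π + v) * U + q * (w π + v) * F + (q * w π + c) * G
    ≤⟨ trivialise-arith q (w π) v c pU≤ G≤U ⟩
  (suc q * w π + c) * U + (suc q * v + q * w π) * F + q * (w π + v) * G
    ≡⟨ cong₂ _+_ (cong₂ (λ a b → a * U + b * F) pw+c≡u (sym f≡))
         (cong (_* G) (sym (trans (trivial-g refl π° tr) (cong (q *_) (sym w+v≡z))))) ⟩
  u π * U + f π * F + g π° * G ∎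
  where
  eq₁ : ∀ q w v → (1 + q) * (w + v) ≡ (1 + q) * v + q * w + w
  eq₁ = solve-∀
  eq₂ : ∀ q w c → (1 + q) * w + c ≡ q * w + c + w
  eq₂ = solve-∀
  f≡ : f π ≡ suc q * v + q * w π
  f≡ = +-cancelʳ-≡ (w π) _ _ (trans (f+w π) (trans (cong (p *_) (sym w+v≡z)) (eq₁ q (w π) v)))
  g≡ : g π ≡ q * w π + c
  g≡ = +-cancelʳ-≡ (w π) _ _ (trans (g+w π) (trans (sym pw+c≡u) (eq₂ q (w π) c)))

trivialProfile : ∀ {p z q} → p ≡ suc q → 1 ≤ z → Profile p z
trivialProfile {p} {z} {q} refl 1≤z = record
  { u = p * z ; w = z ; f = q * z ; g = q * z
  ; f+w = +-comm (q * z) z ; g+w = +-comm (q * z) z ; p*w≤u = ≤-refl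
  ; 1≤u = ≤-trans 1≤z (m≤m+n z (q * z)) ; kind = inj₁ (refl , refl) }

-- Reduction to a single nontrivial prime

-- The last index is wanted because `SeparationAt i j` will be available for `i < j`: everything
-- below the last nontrivial index can be cleared, and everything above it is trivial already.
lastOrNone : ∀ {r} {A B : Fin r → Set} → (∀ k → A k ⊎ B k) →
  (∀ k → A k) ⊎ (∃[ s ] B s × (∀ k → toℕ s < toℕ k → A k))
lastOrNone {zero}  h = inj₁ λ ()
lastOrNone {suc r} h with lastOrNone (h ∘ suc) | h zero
... | inj₂ (s , b , after) | _       = inj₂ (suc s , b , λ { (suc k) (s≤s s<k) → after k s<k })
... | inj₁ all             | inj₁ a  = inj₁ λ { zero → a ; (suc k) → all k }
... | inj₁ all             | inj₂ b  = inj₂ (zero , b , λ { (suc k) _ → all k })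

∸-+-≤ : ∀ {a b c a′ b′ c′} → c ≤ b → c′ ≤ b′ → a + b + c′ ≤ a′ + b′ + c → a + (b ∸ c) ≤ a′ + (b′ ∸ c′)
∸-+-≤ {a} {b} {c} {a′} {b′} {c′} c≤b c′≤b′ h = +-cancelʳ-≤ (c + c′) _ _ (begin
  a + (b ∸ c) + (c + c′)     ≡⟨ eq a (b ∸ c) c c′ ⟩
  a + (b ∸ c + c) + c′       ≡⟨ cong (λ x → a + x + c′) (m∸n+n≡m c≤b) ⟩
  a + b + c′                 ≤⟨ h ⟩
  a′ + b′ + c                ≡⟨ cong (λ x → a′ + x + c) (m∸n+n≡m c′≤b′) ⟨
  a′ + (b′ ∸ c′ + c′) + c    ≡⟨ eq′ a′ (b′ ∸ c′) c c′ ⟩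
  a′ + (b′ ∸ c′) + (c + c′)  ∎)
  where
  eq : ∀ a x c d → a + x + (c + d) ≡ a + (x + c) + d
  eq = solve-∀
  eq′ : ∀ a x c d → a + (x + d) + c ≡ a + x + (c + d)
  eq′ = solve-∀

module Families {m : ℕ} (p q z : Fin (suc m) → ℕ) (p≡ : ∀ k → p k ≡ suc (q k))
                (1≤q : ∀ k → 1 ≤ q k) (1≤z : ∀ k → 1 ≤ z k) where

  Family : Set
  Family = ∀ k → Profile (p k) (z k)

  P F° : Fin (suc m) → ℕ
  P k = p k * z k
  F° k = q k * z k

  1≤p : ∀ k → 1 ≤ p k
  1≤p k = ≤-trans (s≤s z≤n) (≤-reflexive (sym (p≡ k)))

  q≤p : ∀ k → q k ≤ p k
  q≤p k = ≤-trans (n≤1+n (q k)) (≤-reflexive (sym (p≡ k)))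

  1≤P : ∀ k → 1 ≤ P k
  1≤P k = *-mono-≤ (1≤p k) (1≤z k)

  -- 1 + deg x for the family of x: #⟨x⟩ + #{y | x ∈ ⟨y⟩} less the generators of ⟨x⟩, counted twice.
  value : Family → ℕ
  value Π = ∏ (λ k → u (Π k)) + (∏ (λ k → f (Π k)) ∸ ∏ (λ k → g (Π k)))

  value-+ : ∀ Π → value Π + ∏ (λ k → g (Π k)) ≡ ∏ (λ k → u (Π k)) + ∏ (λ k → f (Π k))
  value-+ Π = trans (+-assoc (∏ (λ k → u (Π k))) _ _)
    (cong (∏ (λ k → u (Π k)) +_) (m∸n+n≡m (∏-mono λ k → g≤f (p≡ k) (Π k))))

  value-cong : ∀ {Π Π′ : Family} → (∀ k → Π k ≡ Π′ k) → value Π ≡ value Π′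
  value-cong eq = cong₂ _+_ (∏-cong λ k → cong u (eq k))
    (cong₂ _∸_ (∏-cong λ k → cong f (eq k)) (∏-cong λ k → cong g (eq k)))

  -- ∏_{k ≠ i} (1 − 1/p_k) ≥ p_i / (p_i + p_j − 1), with denominators cleared.
  SeparationAt : Fin (suc m) → Fin (suc m) → Set
  SeparationAt i j = p i * ∏ (p ∘ punchIn i) ≤ ∏ (q ∘ punchIn i) * (p j + q i)

  -- Let ρ be `Φ / R`, the product of the `1 − 1/p_k` over `k ≠ i`. Nontriviality at `j` gives
  -- `p_j U ≤ N`, so `F ≥ ρ N ≥ ρ p_j U`; also `G ≥ ρ U`. Hence `F + q_i G ≥ ρ (p_j + q_i) U`, and
  -- separation says `ρ (p_j + q_i) ≥ p_i`. The proof carries this out multiplied by `R`.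
  removal-bound : ∀ (Π : Family) i j → i ≢ j → SeparationAt i j → Nontrivial (Π j) →
    p i * ∏ (λ k → u (Π (punchIn i k))) ≤
    ∏ (λ k → f (Π (punchIn i k))) + q i * ∏ (λ k → g (Π (punchIn i k)))
  removal-bound Π i j i≢j sep nt = *-cancelʳ-≤ _ _ R {{>-nonZero (1≤∏ λ k → 1≤p (punchIn i k))}} (begin
    p i * U * R                        ≡⟨ eq₁ (p i) U R ⟩
    U * (p i * R)                      ≤⟨ *-monoʳ-≤ U sep ⟩
    U * (Φ * (p j + q i))              ≡⟨ eq₂ U Φ (p j) (q i) ⟩
    Φ * (p j * U) + q i * (Φ * U)      ≤⟨ +-mono-≤ (*-monoʳ-≤ Φ pU≤N) (*-monoʳ-≤ (q i) ΦU≤RG) ⟩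
    Φ * N + q i * (R * G)              ≤⟨ +-monoˡ-≤ _ ΦN≤RF ⟩
    R * F + q i * (R * G)              ≡⟨ eq₃ R F (q i) G ⟩
    (F + q i * G) * R                  ∎)
    where
    ι = punchIn i
    U = ∏ (λ k → u (Π (ι k)))
    F = ∏ (λ k → f (Π (ι k)))
    G = ∏ (λ k → g (Π (ι k)))
    R = ∏ (p ∘ ι)
    Φ = ∏ (q ∘ ι)
    N = ∏ (P ∘ ι)
    eq₁ : ∀ a b c → a * b * c ≡ b * (a * c)
    eq₁ = solve-∀
    eq₂ : ∀ U Φ a b → U * (Φ * (a + b)) ≡ Φ * (a * U) + b * (Φ * U)
    eq₂ = solve-∀
    eq₃ : ∀ R F b G → R * F + b * (R * G) ≡ (F + b * G) * R
    eq₃ = solve-∀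
    pU≤N : p j * U ≤ N
    pU≤N = ∏-mono-gain (p j) (punchOut i≢j) (λ k → u≤ (p≡ (ι k)) (Π (ι k)))
      (subst (λ k → p j * u (Π k) ≤ P k) (sym (punchIn-punchOut i≢j)) nt)
    ΦN≤RF : Φ * N ≤ R * F
    ΦN≤RF = begin
      Φ * N                            ≡⟨ ∏-distrib-* (q ∘ ι) (P ∘ ι) ⟨
      ∏ (λ k → q (ι k) * P (ι k))      ≤⟨ ∏-mono (λ k → q*P≤p*f (p≡ (ι k)) (Π (ι k))) ⟩
      ∏ (λ k → p (ι k) * f (Π (ι k)))  ≡⟨ ∏-distrib-* (p ∘ ι) (λ k → f (Π (ι k))) ⟩
      R * F                            ∎
    ΦU≤RG : Φ * U ≤ R * G
    ΦU≤RG = begin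
      Φ * U                            ≡⟨ ∏-distrib-* (q ∘ ι) (λ k → u (Π (ι k))) ⟨
      ∏ (λ k → q (ι k) * u (Π (ι k)))  ≤⟨ ∏-mono (λ k → q*u≤p*g (p≡ (ι k)) (Π (ι k))) ⟩
      ∏ (λ k → p (ι k) * g (Π (ι k)))  ≡⟨ ∏-distrib-* (p ∘ ι) (λ k → g (Π (ι k))) ⟩
      R * G                            ∎

  value-trivialise : ∀ (Π Π° : Family) i j → i ≢ j → SeparationAt i j → Nontrivial (Π j) →
    Trivial (Π° i) → (∀ k → Π° (punchIn i k) ≡ Π (punchIn i k)) → value Π° ≤ value Π
  value-trivialise Π Π° i j i≢j sep nt tr same = ∸-+-≤
    (∏-mono λ k → g≤f (p≡ k) (Π° k)) (∏-mono λ k → g≤f (p≡ k) (Π k)) (begin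
      ∏ (u ∘′ Π°) + ∏ (f ∘′ Π°) + ∏ (g ∘′ Π)
        ≡⟨ cong₂ _+_ (cong₂ _+_ (split° u) (split° f)) (∏-remove {i = i} (g ∘′ Π)) ⟩
      u (Π° i) * U + f (Π° i) * F + g (Π i) * G
        ≤⟨ trivialise (p≡ i) (Π i) (Π° i) tr (removal-bound Π i j i≢j sep nt)
             (∏-mono λ k → g≤u (p≡ (punchIn i k)) (Π (punchIn i k))) ⟩
      u (Π i) * U + f (Π i) * F + g (Π° i) * G
        ≡⟨ cong₂ _+_ (cong₂ _+_ (∏-remove {i = i} (u ∘′ Π)) (∏-remove {i = i} (f ∘′ Π))) (split° g) ⟨
      ∏ (u ∘′ Π) + ∏ (f ∘′ Π) + ∏ (g ∘′ Π°) ∎)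
    where
    _∘′_ : (∀ {p z} → Profile p z → ℕ) → Family → Fin (suc m) → ℕ
    (h ∘′ Π) k = h (Π k)
    U = ∏ (λ k → u (Π (punchIn i k)))
    F = ∏ (λ k → f (Π (punchIn i k)))
    G = ∏ (λ k → g (Π (punchIn i k)))
    split° : (h : ∀ {p z} → Profile p z → ℕ) → ∏ (h ∘′ Π°) ≡ h (Π° i) * ∏ (λ k → h (Π (punchIn i k)))
    split° h = trans (∏-remove {i = i} (h ∘′ Π°)) (cong (h (Π° i) *_) (∏-cong λ k → cong h (same k)))

  TrivialOff : Fin (suc m) → Family → Set
  TrivialOff s Π = ∀ k → k ≢ s → Trivial (Π k)

  -- Away from `s` the factors `f` and `g` coincide, both being `q * z`, so the difference of
  -- products factors; at `s` the common `w` cancels and `f − g = P − u`.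
  value-single : ∀ Π s → TrivialOff s Π →
    value Π ≡ u (Π s) * ∏ (P ∘ punchIn s) + (P s ∸ u (Π s)) * ∏ (F° ∘ punchIn s)
  value-single Π s tr = cong₂ _+_
    (trans (∏-remove {i = s} (λ k → u (Π k))) (cong (u (Π s) *_) (∏-cong λ k → proj₁ (tr′ k))))
    (trans (cong₂ _∸_
        (trans (∏-remove {i = s} (λ k → f (Π k))) (cong (f (Π s) *_) (∏-cong λ k → trivial-f (p≡ _) (Π _) (tr′ k))))
        (trans (∏-remove {i = s} (λ k → g (Π k))) (cong (g (Π s) *_) (∏-cong λ k → trivial-g (p≡ _) (Π _) (tr′ k)))))
      (trans (sym (*-distribʳ-∸ _ (f (Π s)) (g (Π s)))) (cong (_* ∏ (F° ∘ punchIn s)) f∸g)))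
    where
    tr′ : ∀ k → Trivial (Π (punchIn s k))
    tr′ k = tr (punchIn s k) (punchInᵢ≢i s k)
    f∸g : f (Π s) ∸ g (Π s) ≡ P s ∸ u (Π s)
    f∸g = trans (sym ([m+n]∸[m+o]≡n∸o (w (Π s)) (f (Π s)) (g (Π s))))
      (cong₂ _∸_ (trans (+-comm (w (Π s)) _) (f+w (Π s))) (trans (+-comm (w (Π s)) _) (g+w (Π s))))

  -- The value at the vertex p_s^α_s, whose factor at p_s has u = 1.
  target : Fin (suc m) → ℕ
  target s = 1 * ∏ (P ∘ punchIn s) + (P s ∸ 1) * ∏ (F° ∘ punchIn s)

  F°≤P : ∀ k → F° k ≤ P k
  F°≤P k = *-monoˡ-≤ (z k) (q≤p k)

  -- By `value-single` the value is affine in `u (Π s)`, with slope the product of the `P k` minus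
  -- that of the `F° k` over `k ≠ s`. This slope is nonnegative, and `target s` is the value at
  -- `u = 1`.
  target≤value : ∀ Π s → TrivialOff s Π → target s ≤ value Π
  target≤value Π s tr = ≤-trans
    (shift-weight (1≤u (Π s)) (u≤ (p≡ s) (Π s)) (∏-mono λ k → F°≤P (punchIn s k)))
    (≤-reflexive (sym (value-single Π s tr)))
    where
    shift-weight : ∀ {u P N F} → 1 ≤ u → u ≤ P → F ≤ N → 1 * N + (P ∸ 1) * F ≤ u * N + (P ∸ u) * F
    shift-weight {suc v} {P} {N} {F} _ u≤P F≤N with m≤n⇒∃[o]m+o≡n u≤P
    ... | e , refl = begin
      1 * N + (v + e) * F               ≡⟨ eq₁ v e N F ⟩
      N + e * F + v * F                 ≤⟨ +-monoʳ-≤ (N + e * F) (*-monoʳ-≤ v F≤N) ⟩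
      N + e * F + v * N                 ≡⟨ eq₂ v e N F ⟩
      suc v * N + e * F                 ≡⟨ cong (λ x → suc v * N + x * F) (m+n∸m≡n v e) ⟨
      suc v * N + (v + e ∸ v) * F       ∎
      where
      eq₁ : ∀ v e N F → 1 * N + (v + e) * F ≡ N + e * F + v * F
      eq₁ = solve-∀
      eq₂ : ∀ v e N F → N + e * F + v * N ≡ (1 + v) * N + e * F
      eq₂ = solve-∀

  module _ (sep : ∀ i j → toℕ i < toℕ j → SeparationAt i j) (Π : Family) where

    truncate : ℕ → Family
    truncate l k with toℕ k <? l
    ... | yes _ = trivialProfile (p≡ k) (1≤z k)
    ... | no  _ = Π k

    truncate-< : ∀ l k → toℕ k < l → Trivial (truncate l k)
    truncate-< l k k<l with toℕ k <? l
    ... | yes _  = trivialProfile-trivial (p≡ k) (1≤z k)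
      where
      trivialProfile-trivial : ∀ {p z q} (e : p ≡ suc q) (h : 1 ≤ z) → Trivial (trivialProfile e h)
      trivialProfile-trivial refl _ = refl , refl
    ... | no k≮l = contradiction k<l k≮l

    truncate-≥ : ∀ l k → l ≤ toℕ k → truncate l k ≡ Π k
    truncate-≥ l k l≤k with toℕ k <? l
    ... | yes k<l = contradiction l≤k (<⇒≱ k<l)
    ... | no  _   = refl

    truncate-suc : ∀ l k → toℕ k ≢ l → truncate (suc l) k ≡ truncate l k
    truncate-suc l k k≢l with toℕ k <? suc l | toℕ k <? l
    ... | yes _    | yes _   = refl
    ... | no  _    | no  _   = refl
    ... | yes k<1+l | no k≮l = contradiction (≤∧≢⇒< (m<1+n⇒m≤n k<1+l) k≢l) k≮l
    ... | no k≮1+l | yes k<l = contradiction (m<n⇒m<1+n k<l) k≮1+l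

    -- Each step clears one index. The nontrivial index that `value-trivialise` asks for is always
    -- `s`, which truncation up to `toℕ s` leaves untouched.
    value-truncate : ∀ s → Nontrivial (Π s) → ∀ l → l ≤ toℕ s → value (truncate l) ≤ value Π
    value-truncate s nt zero _ = ≤-reflexive (value-cong λ k → truncate-≥ 0 k z≤n)
    value-truncate s nt (suc l) l<s = ≤-trans
      (value-trivialise (truncate l) (truncate (suc l)) i s i≢s
        (sep i s (≤-trans (s≤s (≤-reflexive i≡l)) l<s))
        (subst Nontrivial (sym (truncate-≥ l s (<⇒≤ l<s))) nt)
        (truncate-< (suc l) i (s≤s (≤-reflexive i≡l)))
        (λ k → truncate-suc l (punchIn i k) λ eq → punchInᵢ≢i i k (toℕ-injective (trans eq (sym i≡l)))))
      (value-truncate s nt l (<⇒≤ l<s))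
      where
      l<r : l < suc m
      l<r = <-trans l<s (toℕ<n s)
      i = fromℕ< l<r
      i≡l : toℕ i ≡ l
      i≡l = toℕ-fromℕ< l<r
      i≢s : i ≢ s
      i≢s i≡s = <⇒≢ l<s (trans (sym i≡l) (cong toℕ i≡s))

    ∃target≤value : ∃[ s ] target s ≤ value Π
    ∃target≤value with lastOrNone (λ k → kind (Π k))
    -- Every profile is trivial, as for a generator, so any index would serve.
    ... | inj₁ tr = zero , target≤value Π zero (λ k _ → tr k)
    ... | inj₂ (s , nt , after) = s , ≤-trans (target≤value (truncate (toℕ s)) s off)
                                        (value-truncate s nt (toℕ s) ≤-refl)
      where
      off : TrivialOff s (truncate (toℕ s))
      off k k≢s with <-cmp (toℕ k) (toℕ s)
      ... | tri< k<s _ _ = truncate-< (toℕ s) k k<s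
      ... | tri≈ _ k≡s _ = contradiction (toℕ-injective k≡s) k≢s
      ... | tri> _ _ s<k = subst Trivial (sym (truncate-≥ (toℕ s) k (<⇒≤ s<k))) (after k s<k)

-- Comparing two prime-power vertices

-- In the next lemmas s and t are the two primes being compared: a = p_s − 1, x = z_s, b = p_t − 1,
-- y = z_t, and N and F are the products of the P_k and of the F°_k over the remaining indices.
target-compare : ∀ a x b y N F → 1 ≤ x → 1 ≤ y →
  suc a * x * N + suc b * y * (a * x * F) + b * y * F ≤
  suc b * y * N + suc a * x * (b * y * F) + a * x * F →
  1 * (suc a * x * N) + (suc b * y ∸ 1) * (a * x * F) ≤
  1 * (suc b * y * N) + (suc a * x ∸ 1) * (b * y * F)
-- The patterns `suc _` let `∸ 1` compute; adding `A + B` then turns the coefficients `P − 1` into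
-- `P`.
target-compare a x@(suc _) b y@(suc _) N F _ _ h = +-cancelʳ-≤ (A + B) _ _ (begin
  1 * (suc a * x * N) + (suc b * y ∸ 1) * A + (A + B) ≡⟨ eq (suc a * x * N) (suc b * y ∸ 1) A B ⟩
  suc a * x * N + suc b * y * A + B                   ≤⟨ h ⟩
  suc b * y * N + suc a * x * B + A                   ≡⟨ eq (suc b * y * N) (suc a * x ∸ 1) B A ⟨
  1 * (suc b * y * N) + (suc a * x ∸ 1) * B + (B + A) ≡⟨ cong (1 * (suc b * y * N) + (suc a * x ∸ 1) * B +_) (+-comm B A) ⟩
  1 * (suc b * y * N) + (suc a * x ∸ 1) * B + (A + B) ∎)
  where
  A = a * x * F
  B = b * y * F
  eq : ∀ n c A B → 1 * n + c * A + (A + B) ≡ n + (1 + c) * A + B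
  eq = solve-∀

-- Split `N = F + E`. The coefficients of `E` compare by `P_s ≤ P_t`; those of `F` reduce after
-- cancellation to `x ≤ y + (b − a) * x * y`, which follows from `a < b` and `1 ≤ y`.
target-antitone : ∀ a x b y N F → a < b → 1 ≤ y → suc a * x ≤ suc b * y → F ≤ N →
  suc a * x * N + suc b * y * (a * x * F) + b * y * F ≤
  suc b * y * N + suc a * x * (b * y * F) + a * x * F
target-antitone a x b (suc y′) N F a<b (s≤s _) Ps≤Pt F≤N
  with m≤n⇒∃[o]m+o≡n a<b | m≤n⇒∃[o]m+o≡n F≤N
... | d , refl | E , refl = begin
  suc a * x * (F + E) + suc b′ * y * (a * x * F) + b′ * y * F
    ≡⟨ eq₁ a x d y′ F E ⟩
  x * F + (rest + suc a * x * E)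
    ≤⟨ +-mono-≤ x*F≤ (+-monoʳ-≤ rest (*-monoˡ-≤ E Ps≤Pt)) ⟩
  (y * F + y * x * F + d * x * y * F) + (rest + suc b′ * y * E)
    ≡⟨ eq₂ a x d y′ F E ⟩
  suc b′ * y * (F + E) + suc a * x * (b′ * y * F) + a * x * F ∎
  where
  y = suc y′
  b′ = suc a + d
  rest = a * x * F + a * x * y * F + a * b′ * x * y * F + b′ * y * F
  x*F≤ : x * F ≤ y * F + y * x * F + d * x * y * F
  x*F≤ = begin
    x * F                             ≤⟨ *-monoˡ-≤ F (m≤m+n x (y′ * x)) ⟩
    y * x * F                         ≤⟨ m≤n+m (y * x * F) (y * F) ⟩
    y * F + y * x * F                 ≤⟨ m≤m+n _ _ ⟩
    y * F + y * x * F + d * x * y * F ∎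
  eq₁ : ∀ a x d y′ F E → let b = 1 + a + d ; y = 1 + y′ in
        (1 + a) * x * (F + E) + (1 + b) * y * (a * x * F) + b * y * F ≡
        x * F + (a * x * F + a * x * y * F + a * b * x * y * F + b * y * F + (1 + a) * x * E)
  eq₁ = solve-∀
  eq₂ : ∀ a x d y′ F E → let b = 1 + a + d ; y = 1 + y′ in
        (y * F + y * x * F + d * x * y * F) + (a * x * F + a * x * y * F + a * b * x * y * F + b * y * F + (1 + b) * y * E) ≡
        (1 + b) * y * (F + E) + (1 + a) * x * (b * y * F) + a * x * F
  eq₂ = solve-∀

-- This serves the case where `s` is the first index; `W` is the product of the remaining `z_k`.
-- Apart from the common `rest`, the terms containing `x` give `h` multiplied by `x * W`, and those
-- without `x` give `b * Φ ≤ suc b * R`. Thus `h` is free of `x`, as it must be when `α_1` is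
-- unrestricted.
target-first : ∀ a x b y R Φ W → suc a * R + a * y * Φ ≤ (y * b + a) * Φ → Φ ≤ R →
  let N = R * W ; F = Φ * W in
  suc a * x * N + suc b * y * (a * x * F) + b * y * F ≤
  suc b * y * N + suc a * x * (b * y * F) + a * x * F
target-first a x b y R Φ W h Φ≤R = begin
  suc a * x * (R * W) + suc b * y * (a * x * (Φ * W)) + b * y * (Φ * W)
    ≡⟨ eq₁ a x b y R Φ W ⟩
  (suc a * R + a * y * Φ) * (x * W) + (rest + b * y * W * Φ)
    ≤⟨ +-mono-≤ (*-monoˡ-≤ (x * W) h) (+-monoʳ-≤ rest (*-mono-≤ (*-monoˡ-≤ W (*-monoˡ-≤ y (n≤1+n b))) Φ≤R)) ⟩
  (y * b + a) * Φ * (x * W) + (rest + suc b * y * W * R)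
    ≡⟨ eq₂ a x b y R Φ W ⟩
  suc b * y * (R * W) + suc a * x * (b * y * (Φ * W)) + a * x * (Φ * W) ∎
  where
  rest = a * b * x * y * Φ * W
  eq₁ : ∀ a x b y R Φ W →
        (1 + a) * x * (R * W) + (1 + b) * y * (a * x * (Φ * W)) + b * y * (Φ * W) ≡
        ((1 + a) * R + a * y * Φ) * (x * W) + (a * b * x * y * Φ * W + b * y * W * Φ)
  eq₁ = solve-∀
  eq₂ : ∀ a x b y R Φ W →
        (y * b + a) * Φ * (x * W) + (a * b * x * y * Φ * W + (1 + b) * y * W * R) ≡
        (1 + b) * y * (R * W) + (1 + a) * x * (b * y * (Φ * W)) + a * x * (Φ * W)
  eq₂ = solve-∀

first-condition-1 : ∀ a b R Φ → suc a * R ≤ b * Φ → suc a * R + a * 1 * Φ ≤ (1 * b + a) * Φ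
first-condition-1 a b R Φ h = ≤-trans (+-monoˡ-≤ _ h) (≤-reflexive (eq a b Φ))
  where
  eq : ∀ a b Φ → b * Φ + a * 1 * Φ ≡ (1 * b + a) * Φ
  eq = solve-∀

-- Once `a * y * Φ` is moved across, the coefficient on the right is `y (b − a) + a`, at least `2 b`
-- because `y ≥ b + 1` and `b > a`. Multiplying by `b + 1` makes the bound on `suc b * R`
-- applicable.
first-condition-≥ : ∀ a b y R Φ → a < b → suc b ≤ y → suc b * R ≤ 2 * (b * Φ) →
  suc a * R + a * y * Φ ≤ (y * b + a) * Φ
first-condition-≥ a b y R Φ a<b b<y h with m≤n⇒∃[o]m+o≡n a<b | m≤n⇒∃[o]m+o≡n b<y
... | d , refl | e , refl = begin
  suc a * R + a * y′ * Φ              ≤⟨ +-monoˡ-≤ (a * y′ * Φ) (*-cancelˡ-≤ {suc a * R} {(y′ * suc d + a) * Φ} (suc b′) core) ⟩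
  (y′ * suc d + a) * Φ + a * y′ * Φ   ≡⟨ eq a d y′ Φ ⟩
  (y′ * b′ + a) * Φ                   ∎
  where
  b′ = suc a + d
  y′ = suc b′ + e
  eq : ∀ a d y Φ → (y * (1 + d) + a) * Φ + a * y * Φ ≡ (y * (1 + a + d) + a) * Φ
  eq = solve-∀
  expand : ∀ a d e Φ → let b = 1 + a + d in
    (1 + b) * (((1 + b + e) * (1 + d) + a) * Φ) ≡
    (1 + a) * (2 * (b * Φ)) + ((1 + d) * (2 * (b * Φ)) + (1 + b) * (d * b + e * (1 + d)) * Φ)
  expand = solve-∀
  core : suc b′ * (suc a * R) ≤ suc b′ * ((y′ * suc d + a) * Φ)
  core = begin
    suc b′ * (suc a * R)                ≡⟨ *-swap (suc b′) (suc a) R ⟩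
    suc a * (suc b′ * R)                ≤⟨ *-monoʳ-≤ (suc a) h ⟩
    suc a * (2 * (b′ * Φ))              ≤⟨ m≤m+n _ _ ⟩
    suc a * (2 * (b′ * Φ)) + (suc d * (2 * (b′ * Φ)) + suc b′ * (d * b′ + e * suc d) * Φ) ≡⟨ expand a d e Φ ⟨
    suc b′ * ((y′ * suc d + a) * Φ)     ∎

module Targets {m : ℕ} (p q z : Fin (suc (suc m)) → ℕ) (p≡ : ∀ k → p k ≡ suc (q k))
               (1≤q : ∀ k → 1 ≤ q k) (1≤z : ∀ k → 1 ≤ z k) (inc : StrictlyIncreasing q) where

  open Families p q z p≡ 1≤q 1≤z public

  module _ {s t : Fin (suc (suc m))} (s≢t : s ≢ t) where

    rest : Fin m → Fin (suc (suc m))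
    rest k = punchIn s (punchIn (punchOut s≢t) k)

    ∏-remove₂ˡ : ∀ h → ∏ (h ∘ punchIn s) ≡ h t * ∏ (h ∘ rest)
    ∏-remove₂ˡ h = trans (∏-remove {i = punchOut s≢t} (h ∘ punchIn s))
      (cong (λ k → h k * ∏ (h ∘ rest)) (punchIn-punchOut s≢t))

    -- Going through the full product and cancelling `h t` avoids an identity between the two orders
    -- of `punchIn`, and both removals end in the same `rest`.
    ∏-remove₂ʳ : ∀ h → (∀ k → 1 ≤ h k) → ∏ (h ∘ punchIn t) ≡ h s * ∏ (h ∘ rest)
    ∏-remove₂ʳ h 1≤h = *-cancelˡ-≡ _ _ (h t) {{>-nonZero (1≤h t)}} (begin-equality
      h t * ∏ (h ∘ punchIn t)     ≡⟨ ∏-remove {i = t} h ⟨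
      ∏ h                         ≡⟨ ∏-remove {i = s} h ⟩
      h s * ∏ (h ∘ punchIn s)     ≡⟨ cong (h s *_) (∏-remove₂ˡ h) ⟩
      h s * (h t * ∏ (h ∘ rest))  ≡⟨ *-swap (h s) (h t) _ ⟩
      h t * (h s * ∏ (h ∘ rest))  ∎)

    1≤F° : ∀ k → 1 ≤ F° k
    1≤F° k = *-mono-≤ (1≤q k) (1≤z k)

    targets-compare : let a = q s ; x = z s ; b = q t ; y = z t ; N = ∏ (P ∘ rest) ; F = ∏ (F° ∘ rest) in
      suc a * x * N + suc b * y * (a * x * F) + b * y * F ≤
      suc b * y * N + suc a * x * (b * y * F) + a * x * F → target t ≤ target s
    targets-compare h = begin
      target t
        ≡⟨ cong₂ (λ A B → 1 * A + (P t ∸ 1) * B) (∏-remove₂ʳ P 1≤P) (∏-remove₂ʳ F° 1≤F°) ⟩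
      1 * (p s * z s * N) + (p t * z t ∸ 1) * (F° s * F)
        ≡⟨ cong₂ (λ A B → 1 * (A * z s * N) + (B * z t ∸ 1) * (F° s * F)) (p≡ s) (p≡ t) ⟩
      1 * (suc (q s) * z s * N) + (suc (q t) * z t ∸ 1) * (F° s * F)
        ≤⟨ target-compare (q s) (z s) (q t) (z t) N F (1≤z s) (1≤z t) h ⟩
      1 * (suc (q t) * z t * N) + (suc (q s) * z s ∸ 1) * (F° t * F)
        ≡⟨ cong₂ (λ A B → 1 * (A * z t * N) + (B * z s ∸ 1) * (F° t * F)) (p≡ t) (p≡ s) ⟨
      1 * (p t * z t * N) + (p s * z s ∸ 1) * (F° t * F)
        ≡⟨ cong₂ (λ A B → 1 * A + (P s ∸ 1) * B) (∏-remove₂ˡ P) (∏-remove₂ˡ F°) ⟨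
      target s ∎
      where
      N = ∏ (P ∘ rest)
      F = ∏ (F° ∘ rest)

  <⇒≢Fin : ∀ {s t : Fin (suc (suc m))} → toℕ s < toℕ t → s ≢ t
  <⇒≢Fin s<t s≡t = <⇒≢ s<t (cong toℕ s≡t)

  target-mono : ∀ {s t} → toℕ s < toℕ t → P s ≤ P t → target t ≤ target s
  target-mono {s} {t} s<t Ps≤Pt = targets-compare (<⇒≢Fin s<t)
    (target-antitone (q s) (z s) (q t) (z t) _ _ (inc s t s<t) (1≤z t)
      (subst₂ (λ A B → A * z s ≤ B * z t) (p≡ s) (p≡ t) Ps≤Pt)
      (∏-mono λ k → F°≤P (rest (<⇒≢Fin s<t) k)))

  module _ {t : Fin (suc (suc m))} (0<t : 0 < toℕ t) where

    private
      0≢t : zero ≢ t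
      0≢t = <⇒≢Fin 0<t
      R = ∏ (p ∘ rest 0≢t)
      Φ = ∏ (q ∘ rest 0≢t)

    first-condition : suc (q zero) * R + q zero * z t * Φ ≤ (z t * q t + q zero) * Φ → target t ≤ target zero
    first-condition h = targets-compare 0≢t (subst₂
      (λ N F → suc (q zero) * z zero * N + suc (q t) * z t * (q zero * z zero * F) + q t * z t * F ≤
               suc (q t) * z t * N + suc (q zero) * z zero * (q t * z t * F) + q zero * z zero * F)
      (sym (∏-distrib-* (p ∘ rest 0≢t) (z ∘ rest 0≢t)))
      (sym (∏-distrib-* (q ∘ rest 0≢t) (z ∘ rest 0≢t)))
      (target-first (q zero) (z zero) (q t) (z t) R Φ (∏ (z ∘ rest 0≢t)) h (∏-mono λ k → q≤p (rest 0≢t k))))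

    target-≤-first-≥ : ∏ (p ∘ suc) ≤ 2 * ∏ (q ∘ suc) → p t ≤ z t → target t ≤ target zero
    target-≤-first-≥ half pt≤zt = first-condition
      (first-condition-≥ (q zero) (q t) (z t) R Φ (inc zero t 0<t) (subst (_≤ z t) (p≡ t) pt≤zt) (begin
        suc (q t) * R      ≡⟨ cong (_* R) (p≡ t) ⟨
        p t * R            ≡⟨ ∏-remove₂ˡ 0≢t p ⟨
        ∏ (p ∘ suc)        ≤⟨ half ⟩
        2 * ∏ (q ∘ suc)    ≡⟨ cong (2 *_) (∏-remove₂ˡ 0≢t q) ⟩
        2 * (q t * Φ)      ∎))

    target-≤-first-last : toℕ t ≡ suc m → z t ≡ 1 → target t ≤ target zero
    target-≤-first-last t≡ zt≡1 = first-condition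
      (subst (λ y → suc (q zero) * R + q zero * y * Φ ≤ (y * q t + q zero) * Φ) (sym zt≡1)
        (first-condition-1 (q zero) (q t) R Φ (begin
          suc (q zero) * R     ≡⟨ cong (_* R) (p≡ zero) ⟨
          p zero * R           ≡⟨ ∏-remove₂ʳ 0≢t p 1≤p ⟨
          -- Leaving out the last index keeps the positions `k`, leaving out the first keeps the
          -- positions `suc k`. Strict increase gives `p_k ≤ p_(k+1) − 1 = q_(k+1)`, factor by
          -- factor.
          ∏ (p ∘ punchIn t)    ≤⟨ ∏-mono (λ k → ≤-trans (≤-reflexive (p≡ (punchIn t k)))
                                    (inc _ (suc k) (s≤s (toℕ-punchIn≤ t k (≤-trans (toℕ<n k) (≤-reflexive (sym t≡))))))) ⟩
          ∏ (q ∘ suc)          ≡⟨ ∏-remove₂ˡ 0≢t q ⟩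
          q t * Φ              ∎)))

  -- Separation from either totient hypothesis

  -- The constant 1/2 comes from `p i < p j`, which gives `2 * p i ≤ p j + q i`.
  half⇒separation : ∀ i j → toℕ i < toℕ j → ∏ (p ∘ punchIn i) ≤ 2 * ∏ (q ∘ punchIn i) → SeparationAt i j
  half⇒separation i j i<j half = begin
    p i * R               ≤⟨ *-monoʳ-≤ (p i) half ⟩
    p i * (2 * Φ)         ≡⟨ eq (p i) Φ ⟩
    Φ * (p i + p i)       ≤⟨ *-monoʳ-≤ Φ (begin
      p i + p i           ≡⟨ trans (cong (p i +_) (p≡ i)) (+-suc (p i) (q i)) ⟩
      suc (p i) + q i     ≤⟨ +-monoˡ-≤ (q i) (subst₂ (λ a b → suc a ≤ b) (sym (p≡ i)) (sym (p≡ j)) (s≤s (inc i j i<j))) ⟩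
      p j + q i           ∎) ⟩
    Φ * (p j + q i)       ∎
    where
    R = ∏ (p ∘ punchIn i)
    Φ = ∏ (q ∘ punchIn i)
    eq : ∀ a b → a * (2 * b) ≡ b * (a + a)
    eq = solve-∀

  Separated : Set
  Separated = (∀ i j → toℕ i < toℕ j → SeparationAt i j) × ∏ (p ∘ suc) ≤ 2 * ∏ (q ∘ suc)

  -- Since `q i ≤ p i`, leaving out an index can only raise the ratio of `∏ q` to `∏ p`, so the
  -- bound 1/2 passes from the full product to each product over `k ≠ i`.
  totient-large⇒separated : ∏ p ≤ 2 * ∏ q → Separated
  totient-large⇒separated h = (λ i j i<j → half⇒separation i j i<j (half i)) , half zero
    where
    half : ∀ i → ∏ (p ∘ punchIn i) ≤ 2 * ∏ (q ∘ punchIn i)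
    half i = *-cancelˡ-≤ (p i) {{>-nonZero (1≤p i)}} (begin
      p i * ∏ (p ∘ punchIn i)        ≡⟨ ∏-remove {i = i} p ⟨
      ∏ p                            ≤⟨ h ⟩
      2 * ∏ q                        ≡⟨ cong (2 *_) (∏-remove {i = i} q) ⟩
      2 * (q i * ∏ (q ∘ punchIn i))  ≤⟨ *-monoʳ-≤ 2 (*-monoˡ-≤ _ (q≤p i)) ⟩
      2 * (p i * ∏ (q ∘ punchIn i))  ≡⟨ *-swap 2 (p i) _ ⟩
      p i * (2 * ∏ (q ∘ punchIn i))  ∎)

  totients-spread⇒separated : (∀ i j → toℕ j ≡ suc (toℕ i) → suc (suc m) * q i ≤ q j) → Separated
  totients-spread⇒separated spread = sep , half
    where
    r = suc (suc m)

    r*q≤q : ∀ i j → toℕ i < toℕ j → r * q i ≤ q j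
    r*q≤q i j i<j = ≤-trans (spread i k (toℕ-fromℕ< 1+i<r)) (qk≤qj (m≤n⇒m<n∨m≡n i<j))
      where
      1+i<r : suc (toℕ i) < r
      1+i<r = ≤-<-trans i<j (toℕ<n j)
      k = fromℕ< 1+i<r
      qk≤qj : suc (toℕ i) < toℕ j ⊎ suc (toℕ i) ≡ toℕ j → q k ≤ q j
      qk≤qj (inj₁ 1+i<j) = <⇒≤ (inc k j (≤-trans (s≤s (≤-reflexive (toℕ-fromℕ< 1+i<r))) 1+i<j))
      qk≤qj (inj₂ 1+i≡j) = ≤-reflexive (cong q (toℕ-injective (trans (toℕ-fromℕ< 1+i<r) 1+i≡j)))

    r≤q : ∀ k → 0 < toℕ k → r ≤ q k
    r≤q k 0<k = ≤-trans (m≤m*n r (q zero) {{>-nonZero (1≤q zero)}}) (r*q≤q zero k 0<k)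

    half : ∏ (p ∘ suc) ≤ 2 * ∏ (q ∘ suc)
    half = *-cancelˡ-≤ r (begin
      r * ∏ (p ∘ suc)          ≡⟨ cong (r *_) (∏-cong (p≡ ∘ suc)) ⟩
      -- The `m + 1` factors satisfy `q ≥ r`, `q ≥ r + 1`, and so on, so the product of the
      -- `(1 + q) / q` is at most `(r + m + 1) / r`, below 2.
      r * ∏ (suc ∘ q ∘ suc)    ≤⟨ ∏-telescope r (q ∘ suc) (increasing⇒+toℕ≤ r (q ∘ suc)
                                    (λ i j i<j → inc (suc i) (suc j) (s≤s i<j)) (λ k → r≤q (suc k) (s≤s z≤n))) ⟩
      (r + suc m) * ∏ (q ∘ suc) ≤⟨ *-monoˡ-≤ (∏ (q ∘ suc)) (+-monoʳ-≤ r (n≤1+n (suc m))) ⟩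
      (r + r) * ∏ (q ∘ suc)    ≡⟨ eq r (∏ (q ∘ suc)) ⟩
      r * (2 * ∏ (q ∘ suc))    ∎)
      where
      eq : ∀ a b → (a + a) * b ≡ a * (2 * b)
      eq = solve-∀

    sep : ∀ i j → toℕ i < toℕ j → SeparationAt i j
    sep zero      j i<j = half⇒separation zero j i<j half
    sep i@(suc _) j i<j = begin
      p i * ∏ (p ∘ punchIn i)          ≡⟨ cong (p i *_) (trans (∏-cong (p≡ ∘ punchIn i)) (sym (*-identityˡ _))) ⟩
      -- The first prime is among these factors, so the telescope starts at 1; with `m + 1` factors
      -- it ends at `1 + (m + 1) = r`.
      p i * (1 * ∏ (suc ∘ q ∘ punchIn i)) ≤⟨ *-monoʳ-≤ (p i) (∏-telescope 1 (q ∘ punchIn i)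
                                          (increasing⇒+toℕ≤ 1 (q ∘ punchIn i) (punchIn-increasing i inc) (1≤q ∘ punchIn i))) ⟩
      p i * (r * Φ)                    ≡⟨ cong (_* (r * Φ)) (p≡ i) ⟩
      suc (q i) * (r * Φ)              ≡⟨ eq (q i) r Φ ⟩
      -- The two summands of `r * p i` are bounded separately: `r * q i` by `p j` through the
      -- spread, and `r` by `q i` because `i` is not the first index.
      Φ * (r * q i + r)                ≤⟨ *-monoʳ-≤ Φ (+-mono-≤ (≤-trans (r*q≤q i j i<j) (q≤p j)) (r≤q i (s≤s z≤n))) ⟩
      Φ * (p j + q i)                  ∎
      where
      Φ = ∏ (q ∘ punchIn i)
      eq : ∀ a r Φ → (1 + a) * (r * Φ) ≡ Φ * (r * a + r)
      eq = solve-∀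

-- Minima, primes and vertices

minList-≤ : ∀ {x xs} → x ∈ xs → minList xs ≤ x
minList-≤ {xs = y ∷ []}     (here refl)  = ≤-refl
minList-≤ {xs = y ∷ z ∷ xs} (here refl)  = m⊓n≤m y _
minList-≤ {xs = y ∷ z ∷ xs} (there x∈xs) = ≤-trans (m⊓n≤n y _) (minList-≤ x∈xs)

-- The member `x` excludes the empty list, on which `minList` takes the default value 0.
minList-greatest : ∀ {c x xs} → x ∈ xs → (∀ {y} → y ∈ xs → c ≤ y) → c ≤ minList xs
minList-greatest {xs = y ∷ []}     _ c≤ = c≤ (here refl)
minList-greatest {xs = y ∷ z ∷ xs} _ c≤ = ⊓-glb (c≤ (here refl)) (minList-greatest {xs = z ∷ xs} (here refl) (c≤ ∘ there))

product-allFin : ∀ {r n} (h : Fin n → ℕ) (f : Fin r → Fin n) → product (map h (tabulate f)) ≡ ∏ (h ∘ f)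
product-allFin {zero}  h f = refl
product-allFin {suc r} h f = cong (h (f zero) *_) (product-allFin h (f ∘ suc))

coprime-^ : ∀ {a b} n → Coprime a b → Coprime a (b ^ n)
coprime-^ zero    cop = coprime-sym (1-coprimeTo _)
coprime-^ (suc n) cop = coprime-* cop (coprime-^ n cop)

distinct-primes-coprime : ∀ {p q} → Prime p → Prime q → p ≢ q → Coprime p q
distinct-primes-coprime {p} {q} pp pq p≢q = prime∤⇒coprime pq q∤p
  where
  q∤p : ¬ q ∣ p
  q∤p q∣p with prime⇒irreducible pp q∣p
  ... | inj₁ refl = prime∤1 pq ∣-refl
  ... | inj₂ refl = p≢q refl

vertex : ∀ n .{{_ : NonZero n}} → ℕ → Fin n
vertex n@(suc _) x = fromℕ< (m%n<n x n)

toℕ-vertex : ∀ n .{{_ : NonZero n}} x → toℕ (vertex n x) ≡ x % n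
toℕ-vertex n@(suc _) x = toℕ-fromℕ< (m%n<n x n)

degOf-vertex : ∀ n .{{_ : NonZero n}} x → degOf n x ≡ deg (vertex n x)
degOf-vertex (suc _) x = refl

δ-≤ : ∀ {n} (a : Fin n) → δ n ≤ deg a
δ-≤ a = minList-≤ (∈-map⁺ deg (∈-allFin a))

δ-greatest : ∀ {n c} → Fin n → (∀ (a : Fin n) → c ≤ deg a) → c ≤ δ n
δ-greatest {n} {c} a₀ c≤deg = minList-greatest (∈-map⁺ deg (∈-allFin a₀)) c≤
  where
  c≤ : ∀ {y} → y ∈ map deg (allFin n) → c ≤ y
  c≤ y∈ with ∈-map⁻ deg y∈
  ... | a , _ , refl = c≤deg a

profile : ∀ {p z x} → LocalCount p (p * z) x → Profile p z
profile {p} {z} {x} lc = record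
  -- The numbers are inferred from these equations: `f` is the count of `above`, and `g` the count
  -- of `below` and `above` together.
  { f+w = L.Σ-above+ ; g+w = L.Σ-both+ ; p*w≤u = L.p*w≤u ; 1≤u = L.1≤u ; kind = trivial-or-not }
  where
  module L = LocalCount lc
  trivial-or-not : (L.u ≡ p * z × p * L.w ≡ L.u) ⊎ p * L.u ≤ p * z
  trivial-or-not with gcd x (p * z) ≟ 1
  ... | yes gcd≡1 = inj₁ (L.gcd≡1⇒ gcd≡1)
  ... | no gcd≢1  = inj₂ (L.gcd≢1⇒ gcd≢1)

-- The minimum degree of the power graph

module Degrees {m : ℕ} (p α : Fin (suc (suc m)) → ℕ) (prime : ∀ k → Prime (p k)) (inc : StrictlyIncreasing p)
               (1≤α : ∀ k → 1 ≤ α k) where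

  -- With this `z`, `p k ^ suc (pred (α k))` reduces to `P k`, so `localCount` applies to `P k`
  -- without conversion.
  q z : Fin (suc (suc m)) → ℕ
  q k = pred (p k)
  z k = p k ^ pred (α k)

  p≡ : ∀ k → p k ≡ suc (q k)
  p≡ k = sym (suc-pred (p k) {{prime⇒nonZero (prime k)}})

  1<p : ∀ k → 1 < p k
  1<p k = nonTrivial⇒n>1 (p k) {{prime⇒nonTrivial (prime k)}}

  1≤q : ∀ k → 1 ≤ q k
  1≤q k = pred-mono-≤ (1<p k)

  1≤z : ∀ k → 1 ≤ z k
  1≤z k = m^n>0 (p k) {{prime⇒nonZero (prime k)}} (pred (α k))

  q-inc : StrictlyIncreasing q
  q-inc i j i<j = pred-mono-< {{prime⇒nonZero (prime i)}} (inc i j i<j)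

  open Targets p q z p≡ 1≤q 1≤z q-inc

  p^α≡P : ∀ k → p k ^ α k ≡ P k
  p^α≡P k = cong (p k ^_) (sym (suc-pred (α k) {{>-nonZero (1≤α k)}}))

  p-injective : ∀ {i j} → p i ≡ p j → i ≡ j
  p-injective {i} {j} eq with <-cmp (toℕ i) (toℕ j)
  ... | tri< i<j _ _ = contradiction eq (<⇒≢ (inc i j i<j))
  ... | tri≈ _ i≡j _ = toℕ-injective i≡j
  ... | tri> _ _ j<i = contradiction (sym eq) (<⇒≢ (inc j i j<i))

  p-coprime : PairwiseCoprime p
  p-coprime i j i≢j = distinct-primes-coprime (prime i) (prime j) (i≢j ∘ p-injective)

  P-coprime : PairwiseCoprime P
  P-coprime i j i≢j = coprime-^ (suc (pred (α j))) (coprime-sym (coprime-^ (suc (pred (α i))) (coprime-sym (p-coprime i j i≢j))))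

  module _ {n : ℕ} (n≡ : n ≡ ∏ P) where

    private instance
      n≢0 : NonZero n
      n≢0 = subst NonZero (sym n≡) (>-nonZero (1≤∏ 1≤P))

    family : Fin n → Family
    family a k = profile (localCount (prime k) (pred (α k)) (toℕ a))

    deg-value : ∀ a → suc (deg a) ≡ value (family a)
    deg-value a = +-cancelʳ-≡ G _ _ (begin-equality
      suc (deg a) + G              ≡⟨ +-suc (deg a) G ⟨
      deg a + suc G                ≡⟨ deg-∏ P-coprime (λ k → >-nonZero (1≤P k)) n≡ a ⟩
      ∏ (λ k → Σ< (P k) (below {P k} (toℕ a))) + F
                                   ≡⟨ cong (_+ F) (∏-cong λ k → LocalCount.Σ-below≡ (localCount (prime k) (pred (α k)) (toℕ a))) ⟩
      ∏ (λ k → Profile.u (family a k)) + F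
                                   ≡⟨ value-+ (family a) ⟨
      value (family a) + G         ∎)
      where
      F = ∏ (λ k → Profile.f (family a k))
      G = ∏ (λ k → Profile.g (family a k))

    P∣n : ∀ k → P k ∣ n
    P∣n k = subst (P k ∣_) (sym n≡) (∣-∏ P k)

    degOf-target : ∀ s → suc (degOf n (p s ^ α s)) ≡ target s
    degOf-target s = begin-equality
      suc (degOf n (p s ^ α s))    ≡⟨ cong suc (degOf-vertex n (p s ^ α s)) ⟩
      suc (deg a)                  ≡⟨ deg-value a ⟩
      value (family a)             ≡⟨ value-single (family a) s off ⟩
      Profile.u (family a s) * ∏ (P ∘ punchIn s) + (P s ∸ Profile.u (family a s)) * ∏ (F° ∘ punchIn s)
        ≡⟨ cong (λ u → u * ∏ (P ∘ punchIn s) + (P s ∸ u) * ∏ (F° ∘ punchIn s))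
                (proj₁ (LocalCount.gcd≡P⇒ (localCount (prime s) (pred (α s)) (toℕ a)) gcd≡P)) ⟩
      target s                     ∎
      where
      a = vertex n (p s ^ α s)
      a≡ : toℕ a ≡ P s % n
      a≡ = trans (toℕ-vertex n (p s ^ α s)) (cong (_% n) (p^α≡P s))
      gcd≡P : gcd (toℕ a) (P s) ≡ P s
      gcd≡P = ∣-antisym (gcd[m,n]∣n (toℕ a) (P s))
        (gcd-greatest (subst (P s ∣_) (sym a≡) (%-presˡ-∣ ∣-refl (P∣n s))) ∣-refl)
      off : TrivialOff s (family a)
      off k k≢s = LocalCount.gcd≡1⇒ (localCount (prime k) (pred (α k)) (toℕ a))
        (coprime⇒gcd≡1 λ (d∣a , d∣P) → P-coprime k s k≢s
          (d∣P , ∣n∣m%n⇒∣m (∣-trans d∣P (P∣n k)) (subst (_ ∣_) a≡ d∣a)))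

    module _ (separated : Separated) (t : Fin (suc (suc m))) (0<t : 0 < toℕ t)
             (α≤αt : ∀ j → 1 ≤ toℕ j → α j ≤ α t)
             (t-last : ∀ t′ → toℕ t < toℕ t′ → ¬ (∀ j → 1 ≤ toℕ j → α j ≤ α t′)) where

      -- If `α t = 1` is maximal, every exponent beyond the first prime is 1, so any later index
      -- would be maximal too, against the choice of `t`.
      αt≡1⇒last : α t ≡ 1 → toℕ t ≡ suc m
      αt≡1⇒last αt≡1 with m≤n⇒m<n∨m≡n (m<1+n⇒m≤n (toℕ<n t))
      ... | inj₂ t≡ = t≡
      ... | inj₁ t<1+m = contradiction (λ j 1≤j → ≤-trans (α≤αt j 1≤j) (≤-trans (≤-reflexive αt≡1) (1≤α t′)))
                           (t-last t′ (≤-reflexive (sym (toℕ-fromℕ< (s≤s t<1+m)))))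
        where
        t′ = fromℕ< (s≤s t<1+m)

      target-t≤zero : target t ≤ target zero
      target-t≤zero = by-exponent (m≤n⇒m<n∨m≡n (1≤α t))
        where
        by-exponent : 1 < α t ⊎ 1 ≡ α t → target t ≤ target zero
        -- An exponent of at least 2 makes `z t = p t ^ (α t − 1)` at least `p t`.
        by-exponent (inj₁ 1<αt) = target-≤-first-≥ 0<t (proj₂ separated)
          (≤-trans (≤-reflexive (sym (^-identityʳ (p t))))
            (^-monoʳ-≤ (p t) {{prime⇒nonZero (prime t)}} (pred-mono-≤ 1<αt)))
        by-exponent (inj₂ 1≡αt) = target-≤-first-last 0<t (αt≡1⇒last (sym 1≡αt))
          (cong (λ a → p t ^ pred a) (sym 1≡αt))

      target-t≤ : ∀ s → toℕ s < toℕ t → target t ≤ target s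
      target-t≤ zero _ = target-t≤zero
      target-t≤ s@(suc _) s<t = target-mono s<t (subst₂ _≤_ (p^α≡P s) (p^α≡P t)
        (≤-trans (^-monoˡ-≤ (α s) (<⇒≤ (inc s t s<t)))
                 (^-monoʳ-≤ (p t) {{prime⇒nonZero (prime t)}} (α≤αt s (s≤s z≤n)))))

      target≤deg : ∀ (a : Fin n) → ∃[ s ] toℕ t ≤ toℕ s × target s ≤ suc (deg a)
      target≤deg a with ∃target≤value (proj₁ separated) (family a)
      ... | s , target≤ with toℕ t ≤? toℕ s
      ...   | yes t≤s = s , t≤s , ≤-trans target≤ (≤-reflexive (sym (deg-value a)))
      ...   | no  t≰s = t , ≤-refl , ≤-trans (target-t≤ s (≰⇒> t≰s))
                                       (≤-trans target≤ (≤-reflexive (sym (deg-value a))))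

      candidates : List ℕ
      candidates = map (λ s → degOf n (p s ^ α s)) (filterᵇ (λ s → toℕ t ≤ᵇ toℕ s) (allFin (suc (suc m))))

      ∈-candidates : ∀ s → toℕ t ≤ toℕ s → degOf n (p s ^ α s) ∈ candidates
      ∈-candidates s t≤s = ∈-map⁺ _ (∈-filter⁺ (λ s → T? (toℕ t ≤ᵇ toℕ s)) (∈-allFin s) (≤⇒≤ᵇ t≤s))

      δ≡minList : δ n ≡ minList candidates
      δ≡minList = ≤-antisym
        (minList-greatest (∈-candidates t ≤-refl) δ≤candidate)
        (δ-greatest (vertex n 0) λ a → let s , t≤s , le = target≤deg a in
          ≤-trans (minList-≤ (∈-candidates s t≤s)) (≤-pred (≤-trans (≤-reflexive (degOf-target s)) le)))
        where
        δ≤candidate : ∀ {y} → y ∈ candidates → δ n ≤ y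
        δ≤candidate y∈ with ∈-map⁻ _ y∈
        ... | s , _ , refl = ≤-trans (δ-≤ (vertex n (p s ^ α s))) (≤-reflexive (sym (degOf-vertex n (p s ^ α s))))

theorem1p3 : (r : ℕ) → 2 ≤ r →
    (p α : Fin r → ℕ) →
    (∀ i → Prime (p i)) →
    (∀ i j → toℕ i < toℕ j → p i < p j) →
    (∀ i → 1 ≤ α i) →
    let n = product (map (λ i → p i ^ α i) (allFin r))
        rad = product (map p (allFin r))
    in
    (rad ≤ 2 * φ rad
      ⊎ (∀ i j → toℕ j ≡ 1 Data.Nat.+ toℕ i → r * φ (p i) ≤ φ (p j))) →
    (t : Fin r) → 1 ≤ toℕ t →
    (∀ j → 1 ≤ toℕ j → α j ≤ α t) →
    (∀ t′ → toℕ t < toℕ t′ → ¬ (∀ j → 1 ≤ toℕ j → α j ≤ α t′)) →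
    δ n ≡ minList (map (λ s → degOf n (p s ^ α s))
                       (filterᵇ (λ s → toℕ t ≤ᵇ toℕ s) (allFin r)))
theorem1p3 r@(suc (suc m)) (s≤s (s≤s _)) p α prime inc 1≤α hyp t 1≤t α≤αt t-last =
  δ≡minList n≡ (separated hyp) t 1≤t α≤αt t-last
  where
  open Degrees p α prime inc 1≤α
  open Targets p q z p≡ 1≤q 1≤z q-inc using (P; Separated; totient-large⇒separated; totients-spread⇒separated)
  n≡ : product (map (λ i → p i ^ α i) (allFin r)) ≡ ∏ P
  n≡ = trans (product-allFin (λ i → p i ^ α i) id) (∏-cong p^α≡P)
  separated : product (map p (allFin r)) ≤ 2 * φ (product (map p (allFin r))) ⊎
              (∀ i j → toℕ j ≡ 1 + toℕ i → r * φ (p i) ≤ φ (p j)) → Separated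
  separated (inj₁ h) = totient-large⇒separated (subst₂ (λ a b → a ≤ 2 * b)
    (product-allFin p id)
    (trans (cong φ (product-allFin p id)) (φ-∏ prime p-coprime)) h)
  separated (inj₂ h) = totients-spread⇒separated λ i j j≡1+i →
    subst₂ (λ a b → r * a ≤ b) (φ-prime (prime i)) (φ-prime (prime j)) (h i j j≡1+i)
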